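{- Let $p$ be a prime and let $F\colon\mathbb{F}_{p^n}\to\mathbb{F}_{p^m}$ be a plateaued function whose preimage distribution is of type $(+)$ or of type $(-)$, where the unique preimage is $F^{ -1}(0)$; that is, either type $(+)$: $|F^{ -1}(0)|=p^{n-m}+p^{n/2}-p^{n/2-m}$ and $|F^{ -1}(\beta)|=p^{n-m}-p^{n/2-m}$ for all $\beta\ne0$, or type $(-)$: $|F^{ -1}(0)|=p^{n-m}-p^{n/2}+p^{n/2-m}$ and $|F^{ -1}(\beta)|=p^{n-m}+p^{n/2-m}$ for all $\beta\neq0$. Then $F$ is bent. More precisely, $W_F(b,0)=-p^{n/2}$ for all $b\in\mathbb{F}_{p^m}^*$ if $F$ is of type $(-)$, and $W_F(b,0)=p^{n/2}$ for all $b\in\mathbb{F}_{p^m}^*$ if $F$ is of type $(+)$.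
   Context: Let $\zeta_p=e^{2\pi i/p}$ and let $\operatorname{Tr}$ denote the absolute trace (of $\mathbb{F}_{p^m}$ or $\mathbb{F}_{p^n}$ to $\mathbb{F}_p$). The Walsh transform of $F\colon\mathbb{F}_{p^n}\to\mathbb{F}_{p^m}$ is $W_F(b,a)=\sum_{x\in\mathbb{F}_{p^n}}\zeta_p^{\operatorname{Tr}(bF(x))-\operatorname{Tr}(ax)}$ for $b\in\mathbb{F}_{p^m}$, $a\in\mathbb{F}_{p^n}$. $F$ is plateaued if for every $b\in\mathbb{F}_{p^m}^*$ there is an integer $s_b$ with $0\le s_b\le n$ such that $|W_F(b,a)|\in\{0,p^{(n+s_b)/2}\}$ for all $a\in\mathbb{F}_{p^n}$. $F$ is bent if $|W_F(b,a)|=p^{n/2}$ for all $b\in\mathbb{F}_{p^m}^*$ and all $a\in\mathbb{F}_{p^n}$. -}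

module Defs where

open import Level using (Level; _⊔_) renaming (suc to lsuc)
open import Algebra.Apartness.Bundles using (HeytingField)
open import Algebra.Bundles using (CommutativeRing; RawRing; Semiring)
import Algebra.Definitions.RawSemiring as RawSemiringOps
open import Data.Fin.Base using (Fin; toℕ)
open import Data.Fin.Properties using (any?) renaming (_≟_ to _≟ᶠ_)
open import Data.Nat.Base as ℕ using (ℕ; zero; suc; NonZero)
open import Data.Nat.Primality using (Prime; prime⇒nonZero)
open import Data.Nat.Properties using (m^n≢0)
open import Data.Product.Base using (∃; _×_; _,_; proj₁)
open import Data.Sum.Base using (_⊎_)
open import Data.Vec.Base using (count; tabulate)
open import Function.Bundles using (Func; Inverse)
open import Relation.Binary.Core using (Rel)
open import Relation.Binary.Definitions using (Decidable)
open import Relation.Binary.PropositionalEquality as ≡ using (_≡_)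
open import Relation.Binary.Structures using (IsStrictPartialOrder)
open import Relation.Nullary.Decidable using (yes; no; map′)
open import Relation.Nullary.Negation using (¬_)

-- The real numbers, given axiomatically as a Cauchy-complete Archimedean
-- ordered field.  The axioms determine ℝ up to isomorphism classically, and
-- the order is not assumed decidable, so that they are also constructively
-- valid.  The square root is included as an operation; its values at negative
-- arguments are unspecified and never used.

record RealNumbers c ℓ₁ ℓ₂ : Set (lsuc (c ⊔ ℓ₁ ⊔ ℓ₂)) where
  infix 4 _<_ _≤_
  infixl 7 _÷_

  field
    heytingField : HeytingField c ℓ₁ ℓ₂

  open HeytingField heytingField public

  commutativeRing : CommutativeRing c ℓ₁
  commutativeRing = record { isCommutativeRing = isCommutativeRing }

  open CommutativeRing commutativeRing public using (rawRing)
  open RawSemiringOps (Semiring.rawSemiring (CommutativeRing.semiring commutativeRing)) public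
    using () renaming (_×_ to _·_)

  fromℕ : ℕ → Carrier
  fromℕ k = k · 1#

  field
    _<_                  : Rel Carrier ℓ₂
    isStrictPartialOrder : IsStrictPartialOrder _≈_ _<_
    <⇒#                  : ∀ {x y} → x < y → x # y
    #⇒<⊎>                : ∀ {x y} → x # y → (x < y) ⊎ (y < x)
    0<1                  : 0# < 1#
    +-monoˡ-<            : ∀ {x y} z → x < y → x + z < y + z
    *-pos                : ∀ {x y} → 0# < x → 0# < y → 0# < x * y

  _≤_ : Rel Carrier ℓ₂
  x ≤ y = ¬ (y < x)

  Cauchy : (ℕ → Carrier) → Set (c ⊔ ℓ₂)
  Cauchy s = ∀ ε → 0# < ε → ∃ λ N → ∀ j k → N ℕ.≤ j → N ℕ.≤ k → s j < s k + ε

  _⟶_ : (ℕ → Carrier) → Carrier → Set (c ⊔ ℓ₂)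
  s ⟶ l = ∀ ε → 0# < ε → ∃ λ N → ∀ k → N ℕ.≤ k → (l < s k + ε) × (s k < l + ε)

  field
    archimedean : ∀ x → ∃ λ k → x < fromℕ k
    complete    : ∀ s → Cauchy s → ∃ λ l → s ⟶ l
    √_          : Carrier → Carrier
    √-nonneg    : ∀ {x} → 0# ≤ x → 0# ≤ √ x
    √-square    : ∀ {x} → 0# ≤ x → √ x * √ x ≈ x

  private
    module < = IsStrictPartialOrder isStrictPartialOrder

  0<fromℕ : ∀ k .{{_ : NonZero k}} → 0# < fromℕ k
  0<fromℕ (suc zero)    = <.<-respʳ-≈ (sym (+-identityʳ 1#)) 0<1
  0<fromℕ (suc (suc k)) =
    <.trans (<.<-respʳ-≈ (sym (+-identityˡ _)) (0<fromℕ (suc k)))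
            (+-monoˡ-< (fromℕ (suc k)) 0<1)

  -- Division of a real number by a positive natural number.  The library
  -- produces the inverse of fromℕ k - 0#.
  _÷_ : Carrier → (k : ℕ) → .{{_ : NonZero k}} → Carrier
  x ÷ k = x * proj₁ (#⇒invertible (#-sym (<⇒# (0<fromℕ k))))

module ComplexNumbers {c ℓ₁ ℓ₂} (ℝ : RealNumbers c ℓ₁ ℓ₂) where
  open RealNumbers ℝ

  record ℂ : Set c where
    constructor _+i_
    field
      re im : Carrier
  open ℂ public

  ℂ-rawRing : RawRing c ℓ₁
  ℂ-rawRing = record
    { Carrier = ℂ
    ; _≈_     = λ z w → (re z ≈ re w) × (im z ≈ im w)
    ; _+_     = λ z w → (re z + re w) +i (im z + im w)
    ; _*_     = λ z w → (re z * re w - im z * im w) +i (re z * im w + im z * re w)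
    ; -_      = λ z → (- re z) +i (- im z)
    ; 0#      = 0# +i 0#
    ; 1#      = 1# +i 0#
    }

  open RawRing ℂ-rawRing public using ()
    renaming (_≈_ to _≈ᶜ_; _+_ to _+ᶜ_; _*_ to _*ᶜ_; -_ to -ᶜ_; 0# to 0ᶜ; 1# to 1ᶜ)
  open RawSemiringOps (RawRing.rawSemiring ℂ-rawRing) public using ()
    renaming (_^_ to _^ᶜ_; sum to sumᶜ)

  ofReal : Carrier → ℂ
  ofReal x = x +i 0#

  ∣_∣ : ℂ → Carrier
  ∣ z ∣ = √ (re z * re z + im z * im z)

  -- w = e^z, by Euler's limit e^z = lim (1 + z/k)^k  (k = 1, 2, …).
  IsExp : ℂ → ℂ → Set (c ⊔ ℓ₂)
  IsExp z w = ((λ k → re (euler k)) ⟶ re w) × ((λ k → im (euler k)) ⟶ im w)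
    where
    euler : ℕ → ℂ
    euler k = (1ᶜ +ᶜ ((re z ÷ suc k) +i (im z ÷ suc k))) ^ᶜ suc k

  -- π, by the property that 2π is the least positive period of t ↦ e^{it}.
  record IsPi (π : Carrier) : Set (c ⊔ ℓ₂) where
    field
      positive : 0# < π
      period   : IsExp (0# +i (π + π)) 1ᶜ
      least    : ∀ t → 0# < t → t < π + π → ¬ IsExp (0# +i t) 1ᶜ

  -- ζ = e^{2πi/p}
  IsZeta : Carrier → (p : ℕ) → .{{_ : NonZero p}} → ℂ → Set (c ⊔ ℓ₂)
  IsZeta π p ζ = IsExp (0# +i ((π + π) ÷ p)) ζ

-- A field with q elements.

record FiniteField c ℓ (q : ℕ) : Set (lsuc (c ⊔ ℓ)) where
  field
    commutativeRing : CommutativeRing c ℓ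

  open CommutativeRing commutativeRing public
  open RawSemiringOps (Semiring.rawSemiring (CommutativeRing.semiring commutativeRing)) public
    using (_^_; sum) renaming (_×_ to _·_)

  field
    0≉1     : ¬ (0# ≈ 1#)
    inverse : ∀ x → ¬ (x ≈ 0#) → ∃ λ y → x * y ≈ 1#
    enum    : Inverse setoid (≡.setoid (Fin q))

  element : Fin q → Carrier
  element = Inverse.from enum

  _≟_ : Decidable _≈_
  x ≟ y = map′ (λ e → trans (sym (Inverse.inverseʳ enum ≡.refl)) (Inverse.inverseʳ enum e))
               (Inverse.to-cong enum)
               (Inverse.to enum x ≟ᶠ Inverse.to enum y)

module AbsoluteTrace {c ℓ} (p n : ℕ) (K : FiniteField c ℓ (p ℕ.^ n)) where
  open FiniteField K

  trace : Carrier → Carrier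
  trace x = sum {n} (λ i → x ^ (p ℕ.^ toℕ i))

  -- The representative in {0, …, p - 1} of an element of the prime field
  -- 𝔽_p ⊆ K.  Elements outside the prime field get the arbitrary value 0;
  -- traces are always inside.
  residue : Carrier → ℕ
  residue y with any? {n = p} (λ k → (toℕ k · 1#) ≟ y)
  ... | yes (k , _) = toℕ k
  ... | no  _       = 0

  Tr : Carrier → ℕ
  Tr x = residue (trace x)

module Walsh
  {r ℓ₁ ℓ₂ a ℓa b ℓb : Level}
  (ℝ : RealNumbers r ℓ₁ ℓ₂)
  (p : ℕ) (p-prime : Prime p) (ζ : ComplexNumbers.ℂ ℝ)
  (n m : ℕ)
  (𝔽ₙ : FiniteField a ℓa (p ℕ.^ n)) (𝔽ₘ : FiniteField b ℓb (p ℕ.^ m))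
  (F : Func (FiniteField.setoid 𝔽ₙ) (FiniteField.setoid 𝔽ₘ))
  where

  open RealNumbers ℝ
  open ComplexNumbers ℝ
  private
    module N = FiniteField 𝔽ₙ
    module M = FiniteField 𝔽ₘ
    module TrN = AbsoluteTrace p n 𝔽ₙ
    module TrM = AbsoluteTrace p m 𝔽ₘ
    instance
      p≢0 : NonZero p
      p≢0 = prime⇒nonZero p-prime
      p^m≢0 : NonZero (p ℕ.^ m)
      p^m≢0 = m^n≢0 p m
  open Func F using (to)

  -- The exponent Tr(bF(x)) - Tr(ax) is an element of ℤ/p; it is represented
  -- by the natural number Tr(bF(x)) + (p - Tr(ax)), using Tr(ax) < p.
  W : M.Carrier → N.Carrier → ℂ
  W β α = sumᶜ λ i → let x = N.element i in
    ζ ^ᶜ (TrM.Tr (β M.* to x) ℕ.+ (p ℕ.∸ TrN.Tr (α N.* x)))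

  -- p^(k/2)
  p^½_ : ℕ → Carrier
  p^½ k = √ fromℕ (p ℕ.^ k)

  Plateaued : Set (a ⊔ b ⊔ ℓ₁ ⊔ ℓb)
  Plateaued = ∀ β → ¬ (β M.≈ M.0#) → ∃ λ s → (s ℕ.≤ n) ×
    (∀ α → (∣ W β α ∣ ≈ 0#) ⊎ (∣ W β α ∣ ≈ p^½ (n ℕ.+ s)))

  Bent : Set (a ⊔ b ⊔ ℓ₁ ⊔ ℓb)
  Bent = ∀ β → ¬ (β M.≈ M.0#) → ∀ α → ∣ W β α ∣ ≈ p^½ n

  -- |F⁻¹(β)|
  preimageSize : M.Carrier → ℕ
  preimageSize β = count (λ x → to x M.≟ β) (tabulate N.element)

  -- p^(n-m) and p^(n/2-m), real numbers whatever the sign and parity of the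
  -- exponents.
  p^[n-m] p^[n/2-m] : Carrier
  p^[n-m]   = fromℕ (p ℕ.^ n) ÷ (p ℕ.^ m)
  p^[n/2-m] = (p^½ n) ÷ (p ℕ.^ m)

  Type⁺ : Set (b ⊔ ℓ₁ ⊔ ℓb)
  Type⁺ = (fromℕ (preimageSize M.0#) ≈ p^[n-m] + p^½ n - p^[n/2-m])
        × (∀ β → ¬ (β M.≈ M.0#) → fromℕ (preimageSize β) ≈ p^[n-m] - p^[n/2-m])

  Type⁻ : Set (b ⊔ ℓ₁ ⊔ ℓb)
  Type⁻ = (fromℕ (preimageSize M.0#) ≈ p^[n-m] - p^½ n + p^[n/2-m])
        × (∀ β → ¬ (β M.≈ M.0#) → fromℕ (preimageSize β) ≈ p^[n-m] + p^[n/2-m])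

-- W(β, 0) is the sum of |F⁻¹(y)| χ(βy) over y, where χ = ζ^Tr.  The preimage sizes are constant
-- except at y = 0, where they differ by ± p^(n/2), and the sum of χ(βy) vanishes for β ≠ 0, so that
-- W(β, 0) = ± p^(n/2).  Hence every nonzero amplitude |W(β, α)| is p^(n/2), and Parseval's
-- identity ∑ |W(β, α)|² = p^(2n) leaves no room for a zero amplitude.
--
-- Of ζ only three facts are needed: ζ^p = 1, because the p-th powers of the Euler sequence of
-- 2πi/p form a subsequence of the Euler sequence of 2πi; |ζ| = 1, which follows; and ζ ≠ 1, because
-- 2π is the least period.  Of the trace: it is additive, it maps into the prime field (the roots
-- of X^p - X), and it is not identically zero (its degree as a polynomial is below p^n).

module Submission where

open import Defs
open import Algebra.Bundles using (CommutativeMonoid; CommutativeRing; Monoid)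
open import Data.Fin.Base as Fin using (Fin; zero; suc; toℕ; inject₁)
import Data.Fin.Properties as Fin
open import Data.Nat.Base as ℕ using (ℕ; zero; suc; _!)
open import Data.Nat.Combinatorics as ℕ using (nCk≡n!/k![n-k]!; k![n∸k]!∣n!; nCn≡1)
open import Data.Nat.Coprimality using (Coprime; coprime-Bézout)
open import Data.Nat.Divisibility using (_∣_; _∤_; _∣?_; divides-refl; ∣⇒≤; m∣m*n; n∣m*n)
open import Data.Nat.DivMod using (m/n*n≡m)
open import Data.Nat.GCD using (module Bézout)
open import Data.Nat.Primality using (Prime; prime⇒nonZero; prime⇒nonTrivial; prime⇒irreducible; ¬prime[0]; ¬prime[1]; euclidsLemma)
import Data.Nat.Properties as ℕ
open import Data.Maybe.Base using (Maybe; just; nothing)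
open import Data.Product.Base using (∃; _×_; _,_; proj₁; proj₂)
open import Data.Sum.Base using (_⊎_; inj₁; inj₂; [_,_]′)
open import Data.Vec.Base using (Vec; []; _∷_; count; tabulate)
open import Function.Bundles using (Func; Inverse)
open import Level using (_⊔_)
open import Relation.Binary.PropositionalEquality as ≡ using (_≡_; _≢_)
import Relation.Binary.Reasoning.Setoid as SetoidReasoning
open import Relation.Binary.Structures using (IsStrictPartialOrder)
open import Relation.Nullary.Decidable using (Dec; yes; no; decidable-stable)
open import Relation.Nullary.Negation using (¬_; contradiction)
open import Relation.Unary using (Pred; Decidable)

-- No real number can be tested for its sign or for being zero, and this shapes the proof. Equations
-- remain accessible because apartness is tight: an equation follows once apartness is refuted. Over
-- ℂ, `¬ (z ≈ᶜ 0ᶜ)` is a bare negation and gives no inverse, so cancellation goes through the norm.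
-- The case distinctions that do occur come from decidable equality in the finite fields and from
-- the disjunction in `Plateaued`. The character theory lives over an arbitrary commutative ring
-- with a root of unity `ζ` and an inverse `ζ⁻¹`. Complex conjugation enters Parseval's identity
-- only afterwards, as the map that exchanges `ζ` and `ζ⁻¹` because |ζ| = 1. Exponents of `ζ` are
-- natural numbers. They are compared through their images `k · 1#` in the finite field, which
-- determine `k` modulo `p`, so no modular arithmetic on residues is carried out.

-- A ring solver with integer coefficients.

module IntegerSolver {c ℓ} (R : CommutativeRing c ℓ) where
  open import Algebra.Properties.Ring (CommutativeRing.ring R) using (-0#≈0#; -‿distribˡ-*; -‿distribʳ-*; -‿involutive)
  open import Algebra.Properties.AbelianGroup (CommutativeRing.+-abelianGroup R) using (⁻¹-∙-comm)
  open import Algebra.Properties.Semiring.Mult.TCOptimised (CommutativeRing.semiring R)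
    using (1+×; ×-homo-+; ×1-homo-*) renaming (_×_ to _·_)
  open import Algebra.Solver.Ring.AlmostCommutativeRing
    using (fromCommutativeRing; _-Raw-AlmostCommutative⟶_)
  open import Data.Integer.Base as ℤ using (ℤ; +_; -[1+_]; _⊖_)
  import Data.Integer.Properties as ℤ
  open CommutativeRing R
  open SetoidReasoning setoid

  -- Integer coefficients have decidable equality whatever the ring, which lets the solver cancel
  -- terms. In the variant of multiples used here `1 · x` computes to `x`, so `#1` denotes `1#`
  -- itself.
  ⟦_⟧ : ℤ → Carrier
  ⟦ + n ⟧      = n · 1#
  ⟦ -[1+ n ] ⟧ = - (suc n · 1#)

  private
    cancel₁ : ∀ x y → (1# + x) - (1# + y) ≈ x - y
    cancel₁ x y = begin
      (1# + x) - (1# + y)       ≈⟨ +-cong (+-comm 1# x) (sym (⁻¹-∙-comm 1# y)) ⟩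
      (x + 1#) + (- 1# + - y)   ≈⟨ +-assoc x 1# _ ⟩
      x + (1# + (- 1# + - y))   ≈⟨ +-congˡ (sym (+-assoc 1# _ _)) ⟩
      x + (1# - 1# + - y)       ≈⟨ +-congˡ (+-congʳ (-‿inverseʳ 1#)) ⟩
      x + (0# + - y)            ≈⟨ +-congˡ (+-identityˡ _) ⟩
      x - y                     ∎

    ⊖-homo : ∀ m n → ⟦ m ⊖ n ⟧ ≈ m · 1# - n · 1#
    ⊖-homo m       zero    = sym (trans (+-congˡ -0#≈0#) (+-identityʳ _))
    ⊖-homo zero    (suc n) = sym (+-identityˡ _)
    ⊖-homo (suc m) (suc n) = begin
      ⟦ suc m ⊖ suc n ⟧              ≡⟨ ≡.cong ⟦_⟧ (ℤ.[1+m]⊖[1+n]≡m⊖n m n) ⟩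
      ⟦ m ⊖ n ⟧                      ≈⟨ ⊖-homo m n ⟩
      m · 1# - n · 1#                ≈⟨ cancel₁ _ _ ⟨
      (1# + m · 1#) - (1# + n · 1#)  ≈⟨ +-cong (1+× m 1#) (-‿cong (1+× n 1#)) ⟨
      suc m · 1# - suc n · 1#        ∎

    ⟦⟧-+ : ∀ i j → ⟦ i ℤ.+ j ⟧ ≈ ⟦ i ⟧ + ⟦ j ⟧
    ⟦⟧-+ (+ m)      (+ n)      = ×-homo-+ 1# m n
    ⟦⟧-+ (+ m)      (-[1+ n ]) = ⊖-homo m (suc n)
    ⟦⟧-+ (-[1+ m ]) (+ n)      = trans (⊖-homo n (suc m)) (+-comm _ _)
    ⟦⟧-+ (-[1+ m ]) (-[1+ n ]) = begin
      - (suc (suc (m ℕ.+ n)) · 1#)       ≡⟨ ≡.cong (λ k → - (suc k · 1#)) (≡.sym (ℕ.+-suc m n)) ⟩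
      - ((suc m ℕ.+ suc n) · 1#)         ≈⟨ -‿cong (×-homo-+ 1# (suc m) (suc n)) ⟩
      - (suc m · 1# + suc n · 1#)        ≈⟨ ⁻¹-∙-comm _ _ ⟨
      - (suc m · 1#) + - (suc n · 1#)    ∎

    ⟦⟧-neg : ∀ i → ⟦ ℤ.- i ⟧ ≈ - ⟦ i ⟧
    ⟦⟧-neg (+ zero)   = sym -0#≈0#
    ⟦⟧-neg (+ suc n)  = refl
    ⟦⟧-neg (-[1+ n ]) = sym (-‿involutive _)

    ⟦⟧-*⁺ : ∀ m n → ⟦ + m ℤ.* + n ⟧ ≈ ⟦ + m ⟧ * ⟦ + n ⟧
    ⟦⟧-*⁺ m n = trans (reflexive (≡.cong ⟦_⟧ (≡.sym (ℤ.pos-* m n)))) (×1-homo-* m n)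

    ⟦⟧-*⁺⁻ : ∀ m n → ⟦ + m ℤ.* -[1+ n ] ⟧ ≈ ⟦ + m ⟧ * ⟦ -[1+ n ] ⟧
    ⟦⟧-*⁺⁻ m n = begin
      ⟦ + m ℤ.* -[1+ n ] ⟧          ≡⟨ ≡.cong ⟦_⟧ (≡.sym (ℤ.neg-distribʳ-* (+ m) (+ suc n))) ⟩
      ⟦ ℤ.- (+ m ℤ.* + suc n) ⟧     ≈⟨ ⟦⟧-neg (+ m ℤ.* + suc n) ⟩
      - ⟦ + m ℤ.* + suc n ⟧         ≈⟨ -‿cong (⟦⟧-*⁺ m (suc n)) ⟩
      - (⟦ + m ⟧ * ⟦ + suc n ⟧)     ≈⟨ -‿distribʳ-* _ _ ⟩
      ⟦ + m ⟧ * ⟦ -[1+ n ] ⟧        ∎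

    ⟦⟧-* : ∀ i j → ⟦ i ℤ.* j ⟧ ≈ ⟦ i ⟧ * ⟦ j ⟧
    ⟦⟧-* (+ m)      (+ n)      = ⟦⟧-*⁺ m n
    ⟦⟧-* (+ m)      (-[1+ n ]) = ⟦⟧-*⁺⁻ m n
    ⟦⟧-* (-[1+ m ]) j          = begin
      ⟦ -[1+ m ] ℤ.* j ⟧            ≡⟨ ≡.cong ⟦_⟧ (≡.sym (ℤ.neg-distribˡ-* (+ suc m) j)) ⟩
      ⟦ ℤ.- (+ suc m ℤ.* j) ⟧       ≈⟨ ⟦⟧-neg (+ suc m ℤ.* j) ⟩
      - ⟦ + suc m ℤ.* j ⟧           ≈⟨ -‿cong (pos j) ⟩
      - (⟦ + suc m ⟧ * ⟦ j ⟧)       ≈⟨ -‿distribˡ-* _ _ ⟩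
      ⟦ -[1+ m ] ⟧ * ⟦ j ⟧          ∎
      where
      pos : ∀ j → ⟦ + suc m ℤ.* j ⟧ ≈ ⟦ + suc m ⟧ * ⟦ j ⟧
      pos (+ n)      = ⟦⟧-*⁺ (suc m) n
      pos (-[1+ n ]) = ⟦⟧-*⁺⁻ (suc m) n

    ℤ⟶R : ℤ.+-*-rawRing -Raw-AlmostCommutative⟶ fromCommutativeRing R
    ℤ⟶R = record
      { ⟦_⟧ = ⟦_⟧ ; +-homo = ⟦⟧-+ ; *-homo = ⟦⟧-* ; -‿homo = ⟦⟧-neg ; 0-homo = refl ; 1-homo = refl }

    _≟ᶻ_ : ∀ i j → Maybe (⟦ i ⟧ ≈ ⟦ j ⟧)
    i ≟ᶻ j with i ℤ.≟ j
    ... | yes ≡.refl = just refl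
    ... | no _       = nothing

  open import Algebra.Solver.Ring ℤ.+-*-rawRing (fromCommutativeRing R) ℤ⟶R _≟ᶻ_ public
    using (Polynomial; solve; con; _:=_; _:+_; _:*_; _:-_; :-_)

  #0 #1 : ∀ {n} → Polynomial n
  #0 = con (+ 0)
  #1 = con (+ 1)

-- Real numbers: order, embedded naturals and division.

module RealProperties {c ℓ₁ ℓ₂} (ℝ : RealNumbers c ℓ₁ ℓ₂) where
  open RealNumbers ℝ hiding (zero)
  open CommutativeRing (RealNumbers.commutativeRing ℝ) using (semiring; ring)
  open import Algebra.Properties.Ring ring using (x∙y⁻¹≈ε⇒x≈y)
  open import Algebra.Properties.Semiring.Mult semiring using (×-homo-+; ×1-homo-*)
  open IntegerSolver (RealNumbers.commutativeRing ℝ)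
  open SetoidReasoning setoid
  module < = IsStrictPartialOrder isStrictPartialOrder

  -- Tightness of apartness. It makes equations provable by contradiction, and replaces the
  -- trichotomy that the order does not offer.
  ¬#⇒≈ : ∀ {x y} → ¬ (x # y) → x ≈ y
  ¬#⇒≈ {x} {y} = proj₁ (tight x y)

  pos-resp : ∀ {x y} → x ≈ y → 0# < x → 0# < y
  pos-resp = <.<-respʳ-≈

  <⇒0<- : ∀ {x y} → x < y → 0# < y - x
  <⇒0<- {x} x<y = <.<-respˡ-≈ (-‿inverseʳ x) (+-monoˡ-< (- x) x<y)

  0<-⇒< : ∀ {x y} → 0# < y - x → x < y
  0<-⇒< {x} {y} h = <.<-respˡ-≈ (+-identityˡ x)
    (<.<-respʳ-≈ (solve 2 (λ x y → y :- x :+ x := y) refl x y) (+-monoˡ-< x h))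

  +-pos : ∀ {x y} → 0# < x → 0# < y → 0# < x + y
  +-pos {x} {y} 0<x 0<y = <.trans 0<y (<.<-respˡ-≈ (+-identityˡ y) (+-monoˡ-< y 0<x))

  0≮0 : ¬ (0# < 0#)
  0≮0 = <.irrefl refl

  -‿pos⇒neg : ∀ {x} → 0# < - x → x < 0#
  -‿pos⇒neg {x} h = 0<-⇒< (pos-resp (sym (+-identityˡ _)) h)

  neg⇒-‿pos : ∀ {x} → x < 0# → 0# < - x
  neg⇒-‿pos h = pos-resp (+-identityˡ _) (<⇒0<- h)

  0≤-resp : ∀ {x y} → x ≈ y → 0# ≤ x → 0# ≤ y
  0≤-resp x≈y 0≤x y<0 = 0≤x (<.<-respˡ-≈ (sym x≈y) y<0)

  <⇒≤ : ∀ {x y} → x < y → x ≤ y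
  <⇒≤ = <.asym

  ≤∧#⇒< : ∀ {x y} → x ≤ y → x # y → x < y
  ≤∧#⇒< x≤y x#y with #⇒<⊎> x#y
  ... | inj₁ x<y = x<y
  ... | inj₂ y<x = contradiction y<x x≤y

  0≤∧≮⇒≈0 : ∀ {x} → 0# ≤ x → ¬ (0# < x) → x ≈ 0#
  0≤∧≮⇒≈0 0≤x 0≮x = sym (¬#⇒≈ (λ 0#x → 0≮x (≤∧#⇒< 0≤x 0#x)))

  -- As `≤` is only a negation, strictness has to come from `0# < y`: by cotransitivity `x + y` is
  -- apart from `0#` or from `y`, and in either case the wrong direction would make `x` negative.
  0≤-+-pos : ∀ {x y} → 0# ≤ x → 0# < y → 0# < x + y
  0≤-+-pos {x} {y} 0≤x 0<y with #-cotrans (<⇒# 0<y) (x + y)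
  ... | inj₁ 0#x+y = ≤∧#⇒< 0≤x+y 0#x+y
    where
    0≤x+y : 0# ≤ x + y
    0≤x+y x+y<0 = 0≤x (-‿pos⇒neg
      (pos-resp (solve 2 (λ x y → :- (x :+ y) :+ y := :- x) refl x y) (+-pos (neg⇒-‿pos x+y<0) 0<y)))
  ... | inj₂ x+y#y with #⇒<⊎> x+y#y
  ... | inj₁ x+y<y = contradiction (-‿pos⇒neg (pos-resp (solve 2 (λ x y → y :- (x :+ y) := :- x) refl x y) (<⇒0<- x+y<y))) 0≤x
  ... | inj₂ y<x+y = <.trans 0<y y<x+y

  0≤-+ : ∀ {x y} → 0# ≤ x → 0# ≤ y → 0# ≤ x + y
  0≤-+ {x} {y} 0≤x 0≤y x+y<0 = 0≤x (-‿pos⇒neg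
    (pos-resp (solve 2 (λ x y → y :+ :- (x :+ y) := :- x) refl x y) (0≤-+-pos 0≤y (neg⇒-‿pos x+y<0))))

  -- Suppose the product is negative. If `x` were positive, `y` could not be, hence would be zero,
  -- and so would the product. Therefore `x` is zero, which again makes the product zero.
  0≤-* : ∀ {x y} → 0# ≤ x → 0# ≤ y → 0# ≤ x * y
  0≤-* {x} {y} 0≤x 0≤y xy<0 = x≮0 x≈0
    where
    x≮0 : ¬ (x ≈ 0#)
    x≮0 x≈0 = <.irrefl (trans (*-congʳ x≈0) (zeroˡ y)) xy<0
    x≈0 : x ≈ 0#
    x≈0 = 0≤∧≮⇒≈0 0≤x λ 0<x →
      <.irrefl (trans (*-congˡ (0≤∧≮⇒≈0 0≤y λ 0<y → <.asym xy<0 (*-pos 0<x 0<y))) (zeroʳ x)) xy<0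

  0≤x² : ∀ x → 0# ≤ x * x
  0≤x² x x²<0 = <.irrefl (trans (*-congʳ x≈0) (zeroˡ x)) x²<0
    where
    x≈0 : x ≈ 0#
    x≈0 = ¬#⇒≈ λ x#0 → <.asym x²<0 (lem (#⇒<⊎> x#0))
      where
      lem : (x < 0#) ⊎ (0# < x) → 0# < x * x
      lem (inj₁ x<0) = pos-resp (solve 1 (λ x → :- x :* :- x := x :* x) refl x) (*-pos (neg⇒-‿pos x<0) (neg⇒-‿pos x<0))
      lem (inj₂ 0<x) = *-pos 0<x 0<x

  0≤+0≤⇒≈0ˡ : ∀ {x y} → 0# ≤ x → 0# ≤ y → x + y ≈ 0# → x ≈ 0#
  0≤+0≤⇒≈0ˡ {x} {y} 0≤x 0≤y x+y≈0 =
    0≤∧≮⇒≈0 0≤x λ 0<x → <.irrefl (sym x+y≈0) (pos-resp (+-comm y x) (0≤-+-pos 0≤y 0<x))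

  x²≈0⇒x≈0 : ∀ {x} → x * x ≈ 0# → x ≈ 0#
  x²≈0⇒x≈0 {x} x²≈0 = ¬#⇒≈ λ x#0 → lem (#⇒<⊎> x#0)
    where
    lem : ¬ ((x < 0#) ⊎ (0# < x))
    lem (inj₁ x<0) = <.irrefl (sym x²≈0) (pos-resp (solve 1 (λ x → :- x :* :- x := x :* x) refl x) (*-pos (neg⇒-‿pos x<0) (neg⇒-‿pos x<0)))
    lem (inj₂ 0<x) = <.irrefl (sym x²≈0) (*-pos 0<x 0<x)

  -- Abstract because the unfolded inverse makes later with-abstractions intractable.
  abstract
    pos⇒inverse : ∀ {x} → 0# < x → ∃ λ y → 0# < y × x * y ≈ 1#
    pos⇒inverse {x} 0<x with #⇒invertible (#-sym (<⇒# 0<x))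
    ... | y , _ , [x-0]y≈1 = y , 0<y , xy≈1
      where
      xy≈1 : x * y ≈ 1#
      xy≈1 = trans (*-congʳ (solve 1 (λ x → x := x :- #0) refl x)) [x-0]y≈1
      0≤y : 0# ≤ y
      0≤y y<0 = <.asym 0<1 (-‿pos⇒neg (pos-resp (trans (solve 2 (λ x y → x :* :- y := :- (x :* y)) refl x y) (-‿cong xy≈1)) (*-pos 0<x (neg⇒-‿pos y<0))))
      0<y : 0# < y
      0<y = ≤∧#⇒< 0≤y (invertible⇒# (- x , [-x][0-y]≈1 , trans (*-comm _ _) [-x][0-y]≈1))
        where
        [-x][0-y]≈1 : - x * (0# - y) ≈ 1#
        [-x][0-y]≈1 = trans (solve 2 (λ x y → :- x :* (#0 :- y) := x :* y) refl x y) xy≈1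

  pos-cancelˡ : ∀ {x y} → 0# < x → x * y ≈ 0# → y ≈ 0#
  pos-cancelˡ {x} {y} 0<x xy≈0 with pos⇒inverse 0<x
  ... | z , _ , xz≈1 = begin
    y            ≈⟨ *-identityˡ y ⟨
    1# * y       ≈⟨ *-congʳ xz≈1 ⟨
    x * z * y    ≈⟨ solve 3 (λ x y z → x :* z :* y := z :* (x :* y)) refl x y z ⟩
    z * (x * y)  ≈⟨ *-congˡ xy≈0 ⟩
    z * 0#       ≈⟨ zeroʳ z ⟩
    0#           ∎

  fromℕ-+ : ∀ m n → fromℕ (m ℕ.+ n) ≈ fromℕ m + fromℕ n
  fromℕ-+ = ×-homo-+ 1#

  fromℕ-* : ∀ m n → fromℕ (m ℕ.* n) ≈ fromℕ m * fromℕ n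
  fromℕ-* = ×1-homo-*

  0≤fromℕ : ∀ n → 0# ≤ fromℕ n
  0≤fromℕ zero    = 0≮0
  0≤fromℕ (suc n) = <⇒≤ (0<fromℕ (suc n))

  fromℕ-mono-< : ∀ {m n} → m ℕ.< n → fromℕ m < fromℕ n
  fromℕ-mono-< {m} {n} m<n with ℕ.m≤n⇒∃[o]m+o≡n m<n
  ... | o , ≡.refl = 0<-⇒< (pos-resp eq (0<fromℕ (suc o)))
    where
    eq : fromℕ (suc o) ≈ fromℕ (suc m ℕ.+ o) - fromℕ m
    eq = begin
      fromℕ (suc o)                         ≈⟨ solve 2 (λ u v → u := v :+ u :- v) refl _ (fromℕ m) ⟩
      fromℕ m + fromℕ (suc o) - fromℕ m     ≈⟨ +-congʳ (sym (fromℕ-+ m (suc o))) ⟩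
      fromℕ (m ℕ.+ suc o) - fromℕ m         ≡⟨ ≡.cong (λ k → fromℕ k - fromℕ m) (ℕ.+-suc m o) ⟩
      fromℕ (suc m ℕ.+ o) - fromℕ m         ∎

  fromℕ-injective : ∀ {m n} → fromℕ m ≈ fromℕ n → m ≡ n
  fromℕ-injective {m} {n} eq = ℕ.≤-antisym (ℕ.≮⇒≥ λ lt → <.irrefl (sym eq) (fromℕ-mono-< lt))
                                           (ℕ.≮⇒≥ λ lt → <.irrefl eq (fromℕ-mono-< lt))

  ÷-* : ∀ x k .{{_ : ℕ.NonZero k}} → x ÷ k * fromℕ k ≈ x
  ÷-* x k with #⇒invertible (#-sym (<⇒# (0<fromℕ k)))
  ... | y , y[k-0]≈1 , _ = begin
    x * y * fromℕ k           ≈⟨ solve 3 (λ x y k → x :* y :* k := x :* (y :* (k :- #0))) refl x y (fromℕ k) ⟩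
    x * (y * (fromℕ k - 0#))  ≈⟨ *-congˡ y[k-0]≈1 ⟩
    x * 1#                    ≈⟨ *-identityʳ x ⟩
    x                         ∎

  ÷-unique : ∀ {x y} k .{{_ : ℕ.NonZero k}} → y * fromℕ k ≈ x → y ≈ x ÷ k
  ÷-unique {x} {y} k yk≈x = x∙y⁻¹≈ε⇒x≈y _ _ (pos-cancelˡ (0<fromℕ k) (begin
    fromℕ k * (y - x ÷ k)             ≈⟨ solve 3 (λ k y z → k :* (y :- z) := y :* k :- z :* k) refl _ y (x ÷ k) ⟩
    y * fromℕ k - x ÷ k * fromℕ k     ≈⟨ +-cong yk≈x (-‿cong (÷-* x k)) ⟩
    x - x                             ≈⟨ -‿inverseʳ x ⟩
    0#                                ∎))

  ÷-pos : ∀ {x} k .{{_ : ℕ.NonZero k}} → 0# < x → 0# < x ÷ k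
  ÷-pos {x} k 0<x = ≤∧#⇒< 0≤x/k (#-sym (x/k#0 (pos⇒inverse 0<x)))
    where
    0≤x/k : 0# ≤ x ÷ k
    0≤x/k x/k<0 = <.asym 0<x (-‿pos⇒neg (pos-resp
      (trans (solve 2 (λ u v → :- u :* v := :- (u :* v)) refl _ _) (-‿cong (÷-* x k)))
      (*-pos (neg⇒-‿pos x/k<0) (0<fromℕ k))))
    x/k#0 : (∃ λ y → 0# < y × x * y ≈ 1#) → x ÷ k # 0#
    x/k#0 (y , _ , xy≈1) = invertible⇒# (fromℕ k * y , trans (*-comm _ _) eq , eq)
      where
      eq : (x ÷ k - 0#) * (fromℕ k * y) ≈ 1#
      eq = begin
        (x ÷ k - 0#) * (fromℕ k * y)  ≈⟨ solve 3 (λ z k y → (z :- #0) :* (k :* y) := z :* k :* y) refl (x ÷ k) _ y ⟩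
        x ÷ k * fromℕ k * y           ≈⟨ *-congʳ (÷-* x k) ⟩
        x * y                         ≈⟨ xy≈1 ⟩
        1#                            ∎

  half : ∀ {x} → 0# < x → ∃ λ y → 0# < y × y + y ≈ x
  half {x} 0<x with pos⇒inverse (+-pos 0<1 0<1)
  ... | h , 0<h , 2h≈1 = h * x , *-pos 0<h 0<x , (begin
    h * x + h * x      ≈⟨ solve 2 (λ h x → h :* x :+ h :* x := (#1 :+ #1) :* h :* x) refl h x ⟩
    (1# + 1#) * h * x  ≈⟨ *-congʳ 2h≈1 ⟩
    1# * x             ≈⟨ *-identityˡ x ⟩
    x                  ∎)

  double-pos⇒pos : ∀ {x} → 0# < x + x → 0# < x
  double-pos⇒pos {x} 0<2x with half 0<2x
  ... | y , 0<y , y+y≈x+x = pos-resp (x∙y⁻¹≈ε⇒x≈y _ _ (pos-cancelˡ (+-pos 0<1 0<1) (begin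
    (1# + 1#) * (y - x)  ≈⟨ solve 2 (λ x y → (#1 :+ #1) :* (y :- x) := (y :+ y) :- (x :+ x)) refl x y ⟩
    (y + y) - (x + x)    ≈⟨ +-congʳ y+y≈x+x ⟩
    (x + x) - (x + x)    ≈⟨ -‿inverseʳ _ ⟩
    0#                   ∎))) 0<y

  open import Algebra.Properties.Semiring.Exp semiring using (_^_)

  private
    geometric : Carrier → ℕ → Carrier
    geometric x zero    = 0#
    geometric x (suc k) = x * geometric x k + 1#

    0≤geometric : ∀ {x} → 0# ≤ x → ∀ k → 0# ≤ geometric x k
    0≤geometric 0≤x zero    = 0≮0
    0≤geometric 0≤x (suc k) = 0≤-+ (0≤-* 0≤x (0≤geometric 0≤x k)) (<⇒≤ 0<1)

    geometric-* : ∀ x k → geometric x k * (x - 1#) ≈ x ^ k - 1#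
    geometric-* x zero    = trans (zeroˡ _) (sym (-‿inverseʳ 1#))
    geometric-* x (suc k) = begin
      (x * geometric x k + 1#) * (x - 1#)           ≈⟨ solve 2 (λ x g → (x :* g :+ #1) :* (x :- #1) := x :* (g :* (x :- #1)) :+ (x :- #1)) refl x _ ⟩
      x * (geometric x k * (x - 1#)) + (x - 1#)     ≈⟨ +-congʳ (*-congˡ (geometric-* x k)) ⟩
      x * (x ^ k - 1#) + (x - 1#)                   ≈⟨ solve 2 (λ x g → x :* (g :- #1) :+ (x :- #1) := x :* g :- #1) refl x _ ⟩
      x * x ^ k - 1#                                ∎

  -- The difference x^(k+1) - 1 is `x - 1#` times the geometric sum 1 + x + ... + x^k. For
  -- nonnegative `x` the term 1 makes that sum positive, so it cancels. Applied to the norm of `ζ`,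
  -- this gives |ζ| = 1.
  ^≈1⇒≈1 : ∀ {x} k → 0# ≤ x → x ^ suc k ≈ 1# → x ≈ 1#
  ^≈1⇒≈1 {x} k 0≤x x^k≈1 = x∙y⁻¹≈ε⇒x≈y _ _ (pos-cancelˡ
    (0≤-+-pos (0≤-* 0≤x (0≤geometric 0≤x k)) 0<1)
    (trans (geometric-* x (suc k)) (trans (+-congʳ x^k≈1) (-‿inverseʳ 1#))))

  -- Null sequences and limits.

  -- The two strict inequalities say -ε < s k < ε without an absolute value, so limit laws reduce to
  -- adding and multiplying positive numbers.
  Null : (ℕ → Carrier) → Set _
  Null s = ∀ ε → 0# < ε → ∃ λ N → ∀ k → N ℕ.≤ k → (0# < ε + s k) × (0# < ε - s k)

  Null-resp : ∀ {s t} → (∀ k → s k ≈ t k) → Null s → Null t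
  Null-resp s≈t ns ε 0<ε with ns ε 0<ε
  ... | N , h = N , λ k N≤k → pos-resp (+-congˡ (s≈t k)) (proj₁ (h k N≤k)) ,
                              pos-resp (+-congˡ (-‿cong (s≈t k))) (proj₂ (h k N≤k))

  -- If `x` were apart from zero, ε could be taken as whichever of `x` and `- x` is positive, and
  -- one of the two bounds would read `0# < 0#`.
  Null-const⇒≈0 : ∀ {x} → Null (λ _ → x) → x ≈ 0#
  Null-const⇒≈0 {x} nx = ¬#⇒≈ λ x#0 → lem (#⇒<⊎> x#0)
    where
    lem : ¬ ((x < 0#) ⊎ (0# < x))
    lem (inj₁ x<0) with nx (- x) (neg⇒-‿pos x<0)
    ... | N , h = 0≮0 (pos-resp (-‿inverseˡ x) (proj₁ (h N ℕ.≤-refl)))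
    lem (inj₂ 0<x) with nx x 0<x
    ... | N , h = 0≮0 (pos-resp (-‿inverseʳ x) (proj₂ (h N ℕ.≤-refl)))

  Null-+ : ∀ {s t} → Null s → Null t → Null (λ k → s k + t k)
  Null-+ {s} {t} ns nt ε 0<ε with half 0<ε
  ... | δ , 0<δ , δ+δ≈ε with ns δ 0<δ | nt δ 0<δ
  ... | M , g | N , h = M ℕ.⊔ N , λ k le →
    let gk = g k (ℕ.m⊔n≤o⇒m≤o M N le) ; hk = h k (ℕ.m⊔n≤o⇒n≤o M N le) in
    pos-resp (trans (solve 3 (λ e s t → (e :+ s) :+ (e :+ t) := (e :+ e) :+ (s :+ t)) refl δ (s k) (t k)) (+-congʳ δ+δ≈ε))
      (+-pos (proj₁ gk) (proj₁ hk)) ,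
    pos-resp (trans (solve 3 (λ e s t → (e :- s) :+ (e :- t) := (e :+ e) :- (s :+ t)) refl δ (s k) (t k)) (+-congʳ δ+δ≈ε))
      (+-pos (proj₂ gk) (proj₂ hk))

  Null-neg : ∀ {s} → Null s → Null (λ k → - s k)
  Null-neg {s} ns ε 0<ε with ns ε 0<ε
  ... | N , h = N , λ k le → proj₂ (h k le) ,
    pos-resp (solve 2 (λ e s → e :+ s := e :- :- s) refl ε (s k)) (proj₁ (h k le))

  Bounded : (ℕ → Carrier) → Set _
  Bounded s = ∃ λ B → 0# < B × ∃ λ N → ∀ k → N ℕ.≤ k → (0# < B + s k) × (0# < B - s k)

  Bounded-const : ∀ x → Bounded (λ _ → x)
  Bounded-const x with archimedean x | archimedean (- x)
  ... | m , x<m | n , -x<n =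
    fromℕ (suc m) + fromℕ (suc n) , +-pos (0<fromℕ (suc m)) (0<fromℕ (suc n)) , 0 , λ _ _ →
    pos-resp (solve 4 (λ o m n x → (n :- :- x) :+ (o :+ (o :+ m)) := (o :+ m) :+ (o :+ n) :+ x) refl 1# (fromℕ m) (fromℕ n) x)
      (+-pos (<⇒0<- -x<n) (+-pos 0<1 (0<fromℕ (suc m)))) ,
    pos-resp (solve 4 (λ o m n x → (m :- x) :+ (o :+ (o :+ n)) := (o :+ m) :+ (o :+ n) :- x) refl 1# (fromℕ m) (fromℕ n) x)
      (+-pos (<⇒0<- x<m) (+-pos 0<1 (0<fromℕ (suc n))))

  Bounded-+ : ∀ {s t} → Bounded s → Bounded t → Bounded (λ k → s k + t k)
  Bounded-+ {s} {t} (B , 0<B , M , g) (C , 0<C , N , h) = B + C , +-pos 0<B 0<C , M ℕ.⊔ N , λ k le →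
    let gk = g k (ℕ.m⊔n≤o⇒m≤o M N le) ; hk = h k (ℕ.m⊔n≤o⇒n≤o M N le) in
    pos-resp (solve 4 (λ B C s t → (B :+ s) :+ (C :+ t) := (B :+ C) :+ (s :+ t)) refl B C (s k) (t k))
      (+-pos (proj₁ gk) (proj₁ hk)) ,
    pos-resp (solve 4 (λ B C s t → (B :- s) :+ (C :- t) := (B :+ C) :- (s :+ t)) refl B C (s k) (t k))
      (+-pos (proj₂ gk) (proj₂ hk))

  Bounded-resp : ∀ {s t} → (∀ k → s k ≈ t k) → Bounded s → Bounded t
  Bounded-resp s≈t (B , 0<B , N , h) = B , 0<B , N , λ k N≤k →
    pos-resp (+-congˡ (s≈t k)) (proj₁ (h k N≤k)) , pos-resp (+-congˡ (-‿cong (s≈t k))) (proj₂ (h k N≤k))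

  Null⇒Bounded : ∀ {s} → Null s → Bounded s
  Null⇒Bounded ns = 1# , 0<1 , ns 1# 0<1

  private
    -- |x| < B and |y| < δ give |xy| < Bδ, because 2(Bδ - xy) = (B - x)(δ + y) + (B + x)(δ - y).
    product-bound : ∀ {B δ x y} → (0# < B + x) × (0# < B - x) → (0# < δ + y) × (0# < δ - y) →
                    (0# < B * δ + x * y) × (0# < B * δ - x * y)
    product-bound {B} {δ} {x} {y} (p , q) (r , s) =
      double-pos⇒pos (pos-resp (solve 4 (λ B δ x y → (B :+ x) :* (δ :+ y) :+ (B :- x) :* (δ :- y)
                                                := (B :* δ :+ x :* y) :+ (B :* δ :+ x :* y)) refl B δ x y)
        (+-pos (*-pos p r) (*-pos q s))) ,
      double-pos⇒pos (pos-resp (solve 4 (λ B δ x y → (B :- x) :* (δ :+ y) :+ (B :+ x) :* (δ :- y)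
                                                := (B :* δ :- x :* y) :+ (B :* δ :- x :* y)) refl B δ x y)
        (+-pos (*-pos q r) (*-pos p s)))

  Bounded-*-Null : ∀ {s t} → Bounded s → Null t → Null (λ k → s k * t k)
  Bounded-*-Null {s} {t} (B , 0<B , M , g) nt ε 0<ε with pos⇒inverse 0<B
  ... | C , 0<C , BC≈1 with nt (C * ε) (*-pos 0<C 0<ε)
  ... | N , h = M ℕ.⊔ N , λ k le →
    let b = product-bound (g k (ℕ.m⊔n≤o⇒m≤o M N le)) (h k (ℕ.m⊔n≤o⇒n≤o M N le)) in
    pos-resp (+-congʳ B[Cε]≈ε) (proj₁ b) , pos-resp (+-congʳ B[Cε]≈ε) (proj₂ b)
    where
    B[Cε]≈ε : B * (C * ε) ≈ ε
    B[Cε]≈ε = trans (sym (*-assoc _ _ _)) (trans (*-congʳ BC≈1) (*-identityˡ ε))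

  infix 4 _⇝_
  _⇝_ : (ℕ → Carrier) → Carrier → Set _
  s ⇝ l = Null (λ k → s k - l)

  ⟶⇒⇝ : ∀ {s l} → s ⟶ l → s ⇝ l
  ⟶⇒⇝ {s} {l} s⟶l ε 0<ε with s⟶l ε 0<ε
  ... | N , h = N , λ k le →
    pos-resp (solve 3 (λ s e l → s :+ e :- l := e :+ (s :- l)) refl (s k) ε l) (<⇒0<- (proj₁ (h k le))) ,
    pos-resp (solve 3 (λ s e l → l :+ e :- s := e :- (s :- l)) refl (s k) ε l) (<⇒0<- (proj₂ (h k le)))

  ⇝-resp : ∀ {s t l} → (∀ k → s k ≈ t k) → s ⇝ l → t ⇝ l
  ⇝-resp s≈t = Null-resp (λ k → +-congʳ (s≈t k))

  ⇝-unique : ∀ {s l m} → s ⇝ l → s ⇝ m → l ≈ m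
  ⇝-unique {s} {l} {m} s⇝l s⇝m = x∙y⁻¹≈ε⇒x≈y _ _ (Null-const⇒≈0
    (Null-resp (λ k → solve 3 (λ s l m → (s :- m) :+ :- (s :- l) := l :- m) refl (s k) l m)
               (Null-+ s⇝m (Null-neg s⇝l))))

  ⇝-const : ∀ x → (λ _ → x) ⇝ x
  ⇝-const x ε 0<ε = 0 , λ _ _ → pos-resp (solve 2 (λ e x → e := e :+ (x :- x)) refl ε x) 0<ε ,
                                pos-resp (solve 2 (λ e x → e := e :- (x :- x)) refl ε x) 0<ε

  ⇝-subsequence : ∀ {s l} (f : ℕ → ℕ) → (∀ k → k ℕ.≤ f k) → s ⇝ l → (λ k → s (f k)) ⇝ l
  ⇝-subsequence f k≤f s⇝l ε 0<ε with s⇝l ε 0<ε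
  ... | N , h = N , λ k N≤k → h (f k) (ℕ.≤-trans N≤k (k≤f k))

  ⇝-+ : ∀ {s t l m} → s ⇝ l → t ⇝ m → (λ k → s k + t k) ⇝ l + m
  ⇝-+ {s} {t} {l} {m} s⇝l t⇝m =
    Null-resp (λ k → solve 4 (λ s t l m → (s :- l) :+ (t :- m) := s :+ t :- (l :+ m)) refl (s k) (t k) l m) (Null-+ s⇝l t⇝m)

  ⇝-neg : ∀ {s l} → s ⇝ l → (λ k → - s k) ⇝ - l
  ⇝-neg {s} {l} s⇝l = Null-resp (λ k → solve 2 (λ s l → :- (s :- l) := :- s :- :- l) refl (s k) l) (Null-neg s⇝l)

  ⇝-* : ∀ {s t l m} → s ⇝ l → t ⇝ m → (λ k → s k * t k) ⇝ l * m
  ⇝-* {s} {t} {l} {m} s⇝l t⇝m =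
    Null-resp (λ k → solve 4 (λ s t l m → t :* (s :- l) :+ l :* (t :- m) := s :* t :- l :* m) refl (s k) (t k) l m)
      (Null-+ (Bounded-*-Null t-bounded s⇝l) (Bounded-*-Null (Bounded-const l) t⇝m))
    where
    t-bounded : Bounded t
    t-bounded = Bounded-resp (λ k → solve 2 (λ t m → (t :- m) :+ m := t) refl (t k) m)
                             (Bounded-+ (Null⇒Bounded t⇝m) (Bounded-const m))

  -- Finite sums of reals.

  open import Algebra.Properties.Semiring.Sum semiring using (sum)

  sum-const : ∀ n x → sum {n} (λ _ → x) ≈ fromℕ n * x
  sum-const zero    x = sym (zeroˡ x)
  sum-const (suc n) x = trans (+-congˡ (sum-const n x)) (solve 2 (λ x k → x :+ k :* x := (#1 :+ k) :* x) refl x (fromℕ n))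

  sum-sub : ∀ {n} (f g : Fin n → Carrier) → sum (λ i → f i - g i) ≈ sum f - sum g
  sum-sub {zero}  f g = sym (-‿inverseʳ 0#)
  sum-sub {suc n} f g = trans (+-congˡ (sum-sub (λ i → f (suc i)) (λ i → g (suc i))))
    (solve 4 (λ x y u v → (x :- y) :+ (u :- v) := (x :+ u) :- (y :+ v)) refl (f zero) (g zero) (sum (λ i → f (suc i))) (sum (λ i → g (suc i))))

  0≤-sum : ∀ {n} (f : Fin n → Carrier) → (∀ i → 0# ≤ f i) → 0# ≤ sum f
  0≤-sum {zero}  f 0≤f = 0≮0
  0≤-sum {suc n} f 0≤f = 0≤-+ (0≤f zero) (0≤-sum (λ i → f (suc i)) (λ i → 0≤f (suc i)))

  sum-0≤≈0⇒≈0 : ∀ {n} (f : Fin n → Carrier) → (∀ i → 0# ≤ f i) → sum f ≈ 0# → ∀ i → f i ≈ 0#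
  sum-0≤≈0⇒≈0 f 0≤f ∑f≈0 zero    = 0≤+0≤⇒≈0ˡ (0≤f zero) (0≤-sum (λ i → f (suc i)) (λ i → 0≤f (suc i))) ∑f≈0
  sum-0≤≈0⇒≈0 f 0≤f ∑f≈0 (suc i) = sum-0≤≈0⇒≈0 (λ i → f (suc i)) (λ i → 0≤f (suc i))
    (0≤+0≤⇒≈0ˡ (0≤-sum (λ i → f (suc i)) (λ i → 0≤f (suc i))) (0≤f zero) (trans (+-comm _ _) ∑f≈0)) i

-- Complex numbers: ring structure, conjugation and norm.

module ComplexProperties {c ℓ₁ ℓ₂} (ℝ : RealNumbers c ℓ₁ ℓ₂) where
  open RealNumbers ℝ
  open ComplexNumbers ℝ
  open RealProperties ℝ
  open IntegerSolver (RealNumbers.commutativeRing ℝ)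
  private module R = CommutativeRing (RealNumbers.commutativeRing ℝ)
  open import Algebra.Properties.Semiring.Exp R.semiring using (_^_)
  open import Algebra.Properties.Semiring.Sum R.semiring using (sum)

  ℂ-commutativeRing : CommutativeRing c ℓ₁
  ℂ-commutativeRing = record
    { Carrier = ℂ ; _≈_ = _≈ᶜ_ ; _+_ = _+ᶜ_ ; _*_ = _*ᶜ_ ; -_ = -ᶜ_ ; 0# = 0ᶜ ; 1# = 1ᶜ
    ; isCommutativeRing = record
      { isRing = record
        { +-isAbelianGroup = record
          { isGroup = record
            { isMonoid = record
              { isSemigroup = record
                { isMagma = record
                  { isEquivalence = record
                    { refl  = refl , refl
                    ; sym   = λ (p , q) → sym p , sym q
                    ; trans = λ (p , q) (r , s) → trans p r , trans q s
                    }
                  ; ∙-cong = λ (p , q) (r , s) → +-cong p r , +-cong q s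
                  }
                ; assoc = λ _ _ _ → +-assoc _ _ _ , +-assoc _ _ _
                }
              ; identity = (λ _ → +-identityˡ _ , +-identityˡ _) , (λ _ → +-identityʳ _ , +-identityʳ _)
              }
            ; inverse = (λ _ → -‿inverseˡ _ , -‿inverseˡ _) , (λ _ → -‿inverseʳ _ , -‿inverseʳ _)
            ; ⁻¹-cong = λ (p , q) → -‿cong p , -‿cong q
            }
          ; comm = λ _ _ → +-comm _ _ , +-comm _ _
          }
        ; *-cong = λ (p , q) (r , s) →
            +-cong (*-cong p r) (-‿cong (*-cong q s)) , +-cong (*-cong p s) (*-cong q r)
        ; *-assoc = λ (a +i b) (c +i d) (e +i f) →
            solve 6 (λ a b c d e f → (a :* c :- b :* d) :* e :- (a :* d :+ b :* c) :* f
                                  := a :* (c :* e :- d :* f) :- b :* (c :* f :+ d :* e)) refl a b c d e f ,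
            solve 6 (λ a b c d e f → (a :* c :- b :* d) :* f :+ (a :* d :+ b :* c) :* e
                                  := a :* (c :* f :+ d :* e) :+ b :* (c :* e :- d :* f)) refl a b c d e f
        ; *-identity =
            (λ (a +i b) → solve 2 (λ a b → #1 :* a :- #0 :* b := a) refl a b ,
                          solve 2 (λ a b → #1 :* b :+ #0 :* a := b) refl a b) ,
            (λ (a +i b) → solve 2 (λ a b → a :* #1 :- b :* #0 := a) refl a b ,
                          solve 2 (λ a b → a :* #0 :+ b :* #1 := b) refl a b)
        ; distrib =
            (λ (a +i b) (c +i d) (e +i f) →
              solve 6 (λ a b c d e f → a :* (c :+ e) :- b :* (d :+ f) := (a :* c :- b :* d) :+ (a :* e :- b :* f)) refl a b c d e f ,
              solve 6 (λ a b c d e f → a :* (d :+ f) :+ b :* (c :+ e) := (a :* d :+ b :* c) :+ (a :* f :+ b :* e)) refl a b c d e f) ,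
            (λ (a +i b) (c +i d) (e +i f) →
              solve 6 (λ a b c d e f → (c :+ e) :* a :- (d :+ f) :* b := (c :* a :- d :* b) :+ (e :* a :- f :* b)) refl a b c d e f ,
              solve 6 (λ a b c d e f → (c :+ e) :* b :+ (d :+ f) :* a := (c :* b :+ d :* a) :+ (e :* b :+ f :* a)) refl a b c d e f)
        }
      ; *-comm = λ (a +i b) (c +i d) →
          solve 4 (λ a b c d → a :* c :- b :* d := c :* a :- d :* b) refl a b c d ,
          solve 4 (λ a b c d → a :* d :+ b :* c := c :* b :+ d :* a) refl a b c d
      }
    }

  private module C = CommutativeRing ℂ-commutativeRing
  open import Algebra.Properties.Semiring.Exp C.semiring using (^-congˡ; ^-congʳ; ^-assocʳ)

  conj : ℂ → ℂ
  conj z = re z +i (- im z)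

  conj-* : ∀ z w → conj (z *ᶜ w) ≈ᶜ conj z *ᶜ conj w
  conj-* (a +i b) (c +i d) =
    solve 4 (λ a b c d → a :* c :- b :* d := a :* c :- :- b :* :- d) refl a b c d ,
    solve 4 (λ a b c d → :- (a :* d :+ b :* c) := a :* :- d :+ :- b :* c) refl a b c d

  conj-^ : ∀ z k → conj (z ^ᶜ k) ≈ᶜ conj z ^ᶜ k
  conj-^ z zero    = refl , solve 0 (:- #0 := #0) refl
  conj-^ z (suc k) = C.trans (conj-* z (z ^ᶜ k)) (C.*-congˡ (conj-^ z k))

  conj-sum : ∀ {n} (f : Fin n → ℂ) → conj (sumᶜ f) ≈ᶜ sumᶜ (λ i → conj (f i))
  conj-sum {zero}  f = refl , solve 0 (:- #0 := #0) refl
  conj-sum {suc n} f = C.trans (refl , solve 2 (λ x y → :- (x :+ y) := :- x :+ :- y) refl _ _)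
                               (C.+-congˡ (conj-sum (λ i → f (suc i))))

  re-sum : ∀ {n} (f : Fin n → ℂ) → re (sumᶜ f) ≈ sum (λ i → re (f i))
  re-sum {zero}  f = refl
  re-sum {suc n} f = +-congˡ (re-sum (λ i → f (suc i)))

  norm : ℂ → Carrier
  norm z = re z * re z + im z * im z

  0≤norm : ∀ z → 0# ≤ norm z
  0≤norm z = 0≤-+ (0≤x² _) (0≤x² _)

  norm-cong : ∀ {z w} → z ≈ᶜ w → norm z ≈ norm w
  norm-cong (p , q) = +-cong (*-cong p p) (*-cong q q)

  norm-* : ∀ z w → norm (z *ᶜ w) ≈ norm z * norm w
  norm-* (a +i b) (c +i d) =
    solve 4 (λ a b c d → (a :* c :- b :* d) :* (a :* c :- b :* d) :+ (a :* d :+ b :* c) :* (a :* d :+ b :* c)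
                      := (a :* a :+ b :* b) :* (c :* c :+ d :* d)) refl a b c d

  norm-1 : norm 1ᶜ ≈ 1#
  norm-1 = solve 0 (#1 :* #1 :+ #0 :* #0 := #1) refl

  norm-^ : ∀ z k → norm (z ^ᶜ k) ≈ norm z ^ k
  norm-^ z zero    = norm-1
  norm-^ z (suc k) = trans (norm-* z (z ^ᶜ k)) (*-congˡ (norm-^ z k))

  norm-0 : norm 0ᶜ ≈ 0#
  norm-0 = solve 0 (#0 :* #0 :+ #0 :* #0 := #0) refl

  norm≈0⇒≈0 : ∀ {z} → norm z ≈ 0# → z ≈ᶜ 0ᶜ
  norm≈0⇒≈0 {z} eq = x²≈0⇒x≈0 (0≤+0≤⇒≈0ˡ (0≤x² (re z)) (0≤x² (im z)) eq) ,
                     x²≈0⇒x≈0 (0≤+0≤⇒≈0ˡ (0≤x² (im z)) (0≤x² (re z)) (trans (+-comm _ _) eq))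

  *-conj : ∀ z → z *ᶜ conj z ≈ᶜ ofReal (norm z)
  *-conj (a +i b) = solve 2 (λ a b → a :* a :- b :* :- b := a :* a :+ b :* b) refl a b ,
                    solve 2 (λ a b → a :* :- b :+ b :* a := #0) refl a b

  -- Division by `z` is not possible from a mere negation. Instead, the norm is multiplicative: a
  -- positive `norm w` would force `norm z` to vanish, so `norm w` is nonnegative and not positive,
  -- hence zero.
  *-cancelˡ-≉0 : ∀ {z w} → ¬ (z ≈ᶜ 0ᶜ) → z *ᶜ w ≈ᶜ 0ᶜ → w ≈ᶜ 0ᶜ
  *-cancelˡ-≉0 {z} {w} z≉0 zw≈0 = norm≈0⇒≈0 (0≤∧≮⇒≈0 (0≤norm w) λ 0<w →
    z≉0 (norm≈0⇒≈0 (pos-cancelˡ 0<w (trans (*-comm _ _) (trans (sym (norm-* z w)) (trans (norm-cong zw≈0) norm-0))))))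

  -- Euler's limit and the properties of `ζ`.

  infix 4 _⇝ᶜ_
  _⇝ᶜ_ : (ℕ → ℂ) → ℂ → Set _
  s ⇝ᶜ l = ((λ k → re (s k)) ⇝ re l) × ((λ k → im (s k)) ⇝ im l)

  ⇝ᶜ-* : ∀ {s t l m} → s ⇝ᶜ l → t ⇝ᶜ m → (λ k → s k *ᶜ t k) ⇝ᶜ l *ᶜ m
  ⇝ᶜ-* (p , q) (r , s) = ⇝-+ (⇝-* p r) (⇝-neg (⇝-* q s)) , ⇝-+ (⇝-* p s) (⇝-* q r)

  ⇝ᶜ-^ : ∀ {s l} k → s ⇝ᶜ l → (λ j → s j ^ᶜ k) ⇝ᶜ l ^ᶜ k
  ⇝ᶜ-^ zero    s⇝l = ⇝-const _ , ⇝-const _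
  ⇝ᶜ-^ (suc k) s⇝l = ⇝ᶜ-* s⇝l (⇝ᶜ-^ k s⇝l)

  ⇝ᶜ-unique : ∀ {s t l m} → (∀ k → s k ≈ᶜ t k) → s ⇝ᶜ l → t ⇝ᶜ m → l ≈ᶜ m
  ⇝ᶜ-unique s≈t (p , q) (r , s) =
    ⇝-unique (⇝-resp (λ k → proj₁ (s≈t k)) p) r , ⇝-unique (⇝-resp (λ k → proj₂ (s≈t k)) q) s

  euler : Carrier → ℕ → ℂ
  euler t k = (1ᶜ +ᶜ ((0# ÷ suc k) +i (t ÷ suc k))) ^ᶜ suc k

  IsExp⇒⇝ᶜ : ∀ {t w} → IsExp (0# +i t) w → euler t ⇝ᶜ w
  IsExp⇒⇝ᶜ (p , q) = ⟶⇒⇝ p , ⟶⇒⇝ q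

  0÷ : ∀ k .{{_ : ℕ.NonZero k}} → 0# ÷ k ≈ 0#
  0÷ k = sym (÷-unique k (zeroˡ _))

  ÷-÷ : ∀ t j k → (t ÷ suc j) ÷ suc k ≈ t ÷ (suc j ℕ.* suc k)
  ÷-÷ t j k = ÷-unique (suc j ℕ.* suc k) (begin
    t ÷ suc j ÷ suc k * fromℕ (suc j ℕ.* suc k)              ≈⟨ *-congˡ (fromℕ-* (suc j) (suc k)) ⟩
    t ÷ suc j ÷ suc k * (fromℕ (suc j) * fromℕ (suc k))      ≈⟨ solve 3 (λ x y z → x :* (y :* z) := x :* z :* y) refl _ _ _ ⟩
    t ÷ suc j ÷ suc k * fromℕ (suc k) * fromℕ (suc j)        ≈⟨ *-congʳ (÷-* (t ÷ suc j) (suc k)) ⟩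
    t ÷ suc j * fromℕ (suc j)                                ≈⟨ ÷-* t (suc j) ⟩
    t                                                        ∎)
    where open SetoidReasoning R.setoid

  -- euler t k is (1 + it/(k+1))^(k+1), so that the index belonging to (p+1)(k+1) is k + p(k+1).
  euler-^ : ∀ t p k → euler (t ÷ suc p) k ^ᶜ suc p ≈ᶜ euler t (k ℕ.+ p ℕ.* suc k)
  euler-^ t p k = C.trans (^-assocʳ _ (suc k) (suc p)) (C.trans (^-congʳ _ (ℕ.*-comm (suc k) (suc p)))
    (^-congˡ (suc p ℕ.* suc k) (C.+-congˡ {1ᶜ} (trans (0÷ (suc k)) (sym (0÷ (suc p ℕ.* suc k))) , ÷-÷ t p k))))

  IsExp-^ : ∀ {t z w} p → IsExp (0# +i (t ÷ suc p)) z → IsExp (0# +i t) w → z ^ᶜ suc p ≈ᶜ w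
  IsExp-^ {t} p expz expw = ⇝ᶜ-unique (euler-^ t p) (⇝ᶜ-^ (suc p) (IsExp⇒⇝ᶜ expz))
    (⇝-subsequence (λ k → k ℕ.+ p ℕ.* suc k) (λ k → ℕ.m≤m+n k _) (proj₁ e) ,
     ⇝-subsequence (λ k → k ℕ.+ p ℕ.* suc k) (λ k → ℕ.m≤m+n k _) (proj₂ e))
    where
    e = IsExp⇒⇝ᶜ expw

  IsExp-resp : ∀ {z w w′} → w ≈ᶜ w′ → IsExp z w → IsExp z w′
  IsExp-resp (p , q) (r , s) = ⟶-resp p r , ⟶-resp q s
    where
    ⟶-resp : ∀ {s l m} → l ≈ m → s ⟶ l → s ⟶ m
    ⟶-resp l≈m s⟶l ε 0<ε with s⟶l ε 0<ε
    ... | N , h = N , λ k le → <.<-respˡ-≈ l≈m (proj₁ (h k le)) , <.<-respʳ-≈ (+-congʳ l≈m) (proj₂ (h k le))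

  ÷-<-self : ∀ {t} k → 0# < t → t ÷ (2 ℕ.+ k) < t
  ÷-<-self {t} k 0<t = 0<-⇒< (pos-resp eq (*-pos (÷-pos (2 ℕ.+ k) 0<t) (0<fromℕ (suc k))))
    where
    open SetoidReasoning R.setoid
    eq : t ÷ (2 ℕ.+ k) * fromℕ (suc k) ≈ t - t ÷ (2 ℕ.+ k)
    eq = begin
      t ÷ (2 ℕ.+ k) * fromℕ (suc k)                        ≈⟨ solve 2 (λ x y → x :* y := x :* (#1 :+ y) :- x) refl _ _ ⟩
      t ÷ (2 ℕ.+ k) * fromℕ (2 ℕ.+ k) - t ÷ (2 ℕ.+ k)      ≈⟨ +-congʳ (÷-* t (2 ℕ.+ k)) ⟩
      t - t ÷ (2 ℕ.+ k)                                    ∎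

  ζ^p≈1 : ∀ {π} → IsPi π → ∀ {p} (p-prime : Prime p) {ζ} → IsZeta π p {{prime⇒nonZero p-prime}} ζ → ζ ^ᶜ p ≈ᶜ 1ᶜ
  ζ^p≈1 isPi {zero}  p-prime _    = contradiction p-prime ¬prime[0]
  ζ^p≈1 isPi {suc p} p-prime expζ = IsExp-^ p expζ (IsPi.period isPi)

  ζ≉1 : ∀ {π} → IsPi π → ∀ {p} (p-prime : Prime p) {ζ} → IsZeta π p {{prime⇒nonZero p-prime}} ζ → ¬ (ζ ≈ᶜ 1ᶜ)
  ζ≉1 isPi {zero}        p-prime _        = contradiction p-prime ¬prime[0]
  ζ≉1 isPi {suc zero}    p-prime _        = contradiction p-prime ¬prime[1]
  ζ≉1 isPi {suc (suc p)} p-prime expζ ζ≈1 =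
    IsPi.least isPi _ (÷-pos (2 ℕ.+ p) 0<2π) (÷-<-self p 0<2π) (IsExp-resp ζ≈1 expζ)
    where
    0<2π = +-pos (IsPi.positive isPi) (IsPi.positive isPi)

  ζ*conjζ≈1 : ∀ k {ζ} → ζ ^ᶜ suc k ≈ᶜ 1ᶜ → ζ *ᶜ conj ζ ≈ᶜ 1ᶜ
  ζ*conjζ≈1 k {ζ} ζ^k≈1 = C.trans (*-conj ζ) (^≈1⇒≈1 k (0≤norm ζ)
    (trans (sym (norm-^ ζ (suc k))) (trans (norm-cong ζ^k≈1) norm-1)) , refl)

-- Primes, factorials and binomial coefficients.

prime∤⇒coprime : ∀ {p k} → Prime p → p ∤ k → Coprime k p
prime∤⇒coprime p-prime p∤k (d∣k , d∣p) with prime⇒irreducible p-prime d∣p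
... | inj₁ d≡1    = d≡1
... | inj₂ ≡.refl = contradiction d∣k p∤k

prime∤! : ∀ {p} → Prime p → ∀ k → k ℕ.< p → p ∤ k !
prime∤! {p} p-prime zero    _   p∣1 = ℕ.<⇒≱ (ℕ.nonTrivial⇒n>1 p {{prime⇒nonTrivial p-prime}}) (∣⇒≤ p∣1)
prime∤! p-prime (suc k) k<p p∣k! with euclidsLemma (suc k) (k !) p-prime p∣k!
... | inj₁ p∣1+k = ℕ.<⇒≱ k<p (∣⇒≤ p∣1+k)
... | inj₂ p∣k!  = prime∤! p-prime k (ℕ.<⇒≤ k<p) p∣k!

binomial*factorials : ∀ {n k} → k ℕ.≤ n → (n ℕ.C k) ℕ.* (k ! ℕ.* (n ℕ.∸ k) !) ≡ n !
binomial*factorials {n} {k} k≤n =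
  ≡.trans (≡.cong (ℕ._* (k ! ℕ.* (n ℕ.∸ k) !)) (nCk≡n!/k![n-k]! k≤n)) (m/n*n≡m (k![n∸k]!∣n! k≤n))
  where instance _ = ℕ._!*_!≢0 k (n ℕ.∸ k)

prime∣! : ∀ {p} → Prime p → p ∣ p !
prime∣! {zero}  p-prime = contradiction p-prime ¬prime[0]
prime∣! {suc p} _       = m∣m*n (p !)

-- The prime divides `p !`, which is the coefficient times the factorials of `k` and `p ∸ k`. Both
-- numbers are below `p`, so neither factorial is divisible by `p`.
prime∣binomial : ∀ {p} → Prime p → ∀ {k} → 0 ℕ.< k → k ℕ.< p → p ∣ (p ℕ.C k)
prime∣binomial {p} p-prime {k} 0<k k<p
  with euclidsLemma (p ℕ.C k) (k ! ℕ.* (p ℕ.∸ k) !) p-prime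
         (≡.subst (p ∣_) (≡.sym (binomial*factorials (ℕ.<⇒≤ k<p))) (prime∣! p-prime))
... | inj₁ p∣C = p∣C
... | inj₂ p∣k!l! with euclidsLemma (k !) _ p-prime p∣k!l!
... | inj₁ p∣k! = contradiction p∣k! (prime∤! p-prime k k<p)
... | inj₂ p∣l! = contradiction p∣l! (prime∤! p-prime (p ℕ.∸ k) (ℕ.∸-monoʳ-< 0<k (ℕ.<⇒≤ k<p)))

-- Orders in a monoid: read additively the characteristic, read multiplicatively the order of `ζ`.

module MonoidMultiples {c ℓ} (M : Monoid c ℓ) where
  open Monoid M
  open import Algebra.Properties.Monoid.Mult M using (×-congʳ; ×-congˡ; ×-assocˡ) renaming (_×_ to _·_)
  open SetoidReasoning setoid

  ·-ε : ∀ n → n · ε ≈ ε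
  ·-ε zero    = refl
  ·-ε (suc n) = trans (identityˡ _) (·-ε n)

  ∣⇒·≈ε : ∀ {m n x} → m ∣ n → m · x ≈ ε → n · x ≈ ε
  ∣⇒·≈ε {m} {x = x} (divides-refl q) mx≈ε = trans (sym (×-assocˡ x q m)) (trans (×-congʳ q mx≈ε) (·-ε q))

  private
    bezout : ∀ {m n x} a b → 1 ℕ.+ b ℕ.* n ≡ a ℕ.* m → m · x ≈ ε → n · x ≈ ε → x ≈ ε
    bezout {m} {n} {x} a b eq mx≈ε nx≈ε = begin
      x                        ≈⟨ identityʳ x ⟨
      x ∙ ε                    ≈⟨ ∙-congˡ (∣⇒·≈ε (n∣m*n b) nx≈ε) ⟨
      x ∙ (b ℕ.* n) · x        ≈⟨ ×-congˡ eq ⟩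
      (a ℕ.* m) · x            ≈⟨ ∣⇒·≈ε (n∣m*n a) mx≈ε ⟩
      ε                        ∎

  -- Bézout's identity is used in its subtraction-free form, 1 + b n = a m or the same with the
  -- roles exchanged. No inverses are needed, so the multiplicative monoid of a ring is admissible.
  coprime-·≈ε : ∀ {m n x} → Coprime m n → m · x ≈ ε → n · x ≈ ε → x ≈ ε
  coprime-·≈ε cop mx≈ε nx≈ε with coprime-Bézout cop
  ... | Bézout.+- a b eq = bezout a b eq mx≈ε nx≈ε
  ... | Bézout.-+ a b eq = bezout b a eq nx≈ε mx≈ε

module SumProperties {c ℓ} (M : CommutativeMonoid c ℓ) where
  open CommutativeMonoid M
  open import Algebra.Properties.CommutativeMonoid.Sum M

  sum-single : ∀ {n} (f : Fin n → Carrier) i → (∀ j → j ≢ i → f j ≈ ε) → sum f ≈ f i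
  sum-single {suc n} f i f≈ε = trans (sum-remove {i = i} f) (trans
    (∙-congˡ (trans (sum-cong-≋ (λ j → f≈ε (Fin.punchIn i j) (Fin.punchInᵢ≢i i j))) (sum-replicate-zero n)))
    (identityʳ _))

-- Finite fields: sums and products over all elements, x^q = x, and roots of polynomial functions.

module FiniteFieldProperties {c ℓ q} (K : FiniteField c ℓ q) where
  open FiniteField K hiding (zero)
  open import Algebra.Properties.Ring ring using (x∙y⁻¹≈ε⇒x≈y)
  open import Algebra.Properties.Group +-group using () renaming (identityʳ-unique to +-identityʳ-unique)
  open import Algebra.Properties.Semiring.Sum semiring using (sum-cong-≋; ∑-distrib-+; sum-replicate)
  open IntegerSolver commutativeRing
  open SetoidReasoning setoid

  index : Carrier → Fin q
  index = Inverse.to enum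

  element-index : ∀ x → element (index x) ≈ x
  element-index x = Inverse.strictlyInverseʳ enum x

  index-element : ∀ i → index (element i) ≡ i
  index-element i = Inverse.strictlyInverseˡ enum i

  element-injective : ∀ {i j} → element i ≈ element j → i ≡ j
  element-injective eq = ≡.trans (≡.sym (index-element _)) (≡.trans (Inverse.to-cong enum eq) (index-element _))

  *-cancelˡ-≉0 : ∀ {x y} → ¬ (x ≈ 0#) → x * y ≈ 0# → y ≈ 0#
  *-cancelˡ-≉0 {x} {y} x≉0 xy≈0 with inverse x x≉0
  ... | z , xz≈1 = begin
    y            ≈⟨ *-identityˡ y ⟨
    1# * y       ≈⟨ *-congʳ xz≈1 ⟨
    x * z * y    ≈⟨ solve 3 (λ x y z → x :* z :* y := z :* (x :* y)) refl x y z ⟩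
    z * (x * y)  ≈⟨ *-congˡ xy≈0 ⟩
    z * 0#       ≈⟨ zeroʳ z ⟩
    0#           ∎

  ^≈0⇒≈0 : ∀ {x} k → x ^ k ≈ 0# → x ≈ 0#
  ^≈0⇒≈0 zero    1≈0 = contradiction (sym 1≈0) 0≉1
  ^≈0⇒≈0 {x} (suc k) x^k≈0 with x ≟ 0#
  ... | yes x≈0 = x≈0
  ... | no  x≉0 = ^≈0⇒≈0 k (*-cancelˡ-≉0 x≉0 x^k≈0)

  module _ {c′ ℓ′} (M : CommutativeMonoid c′ ℓ′) where
    private module M = CommutativeMonoid M
    open import Algebra.Properties.CommutativeMonoid.Sum M using () renaming (sum to Σ; sum-permute to Σ-permute; sum-cong-≋ to Σ-cong)
    open import Data.Fin.Permutation using (permutation)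

    -- Conjugated by the enumeration, the bijection `σ` becomes a permutation of the indices. The
    -- target is any commutative monoid because sums in the field, products in the field and sums of
    -- character values are all reindexed this way.
    sum-reindex : ∀ (f : Carrier → M.Carrier) → (∀ {x y} → x ≈ y → f x M.≈ f y) →
                  ∀ (σ τ : Carrier → Carrier) → (∀ {x y} → x ≈ y → σ x ≈ σ y) → (∀ {x y} → x ≈ y → τ x ≈ τ y) →
                  (∀ x → σ (τ x) ≈ x) → (∀ x → τ (σ x) ≈ x) →
                  Σ (λ i → f (element i)) M.≈ Σ (λ i → f (σ (element i)))
    sum-reindex f f-cong σ τ σ-cong τ-cong στ≈id τσ≈id = M.trans
      (Σ-permute (λ i → f (element i)) (permutation (λ i → index (σ (element i))) (λ i → index (τ (element i)))
        (inv σ-cong στ≈id) (inv τ-cong τσ≈id)))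
      (Σ-cong (λ i → f-cong (element-index (σ (element i)))))
      where
      inv : ∀ {σ τ : Carrier → Carrier} → (∀ {x y} → x ≈ y → σ x ≈ σ y) → (∀ x → σ (τ x) ≈ x) →
            ∀ i → index (σ (element (index (τ (element i))))) ≡ i
      inv σ-cong στ≈id i = ≡.trans
        (Inverse.to-cong enum (trans (σ-cong (element-index _)) (στ≈id (element i)))) (index-element i)

    sum-shift : ∀ (f : Carrier → M.Carrier) → (∀ {x y} → x ≈ y → f x M.≈ f y) → ∀ y →
                Σ (λ i → f (element i)) M.≈ Σ (λ i → f (y + element i))
    sum-shift f f-cong y = sum-reindex f f-cong (y +_) (- y +_) +-congˡ +-congˡ
      (λ x → solve 2 (λ x y → y :+ (:- y :+ x) := x) refl x y)
      (λ x → solve 2 (λ x y → :- y :+ (y :+ x) := x) refl x y)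

    sum-scale : ∀ (f : Carrier → M.Carrier) → (∀ {x y} → x ≈ y → f x M.≈ f y) → ∀ {y} → ¬ (y ≈ 0#) →
                Σ (λ i → f (element i)) M.≈ Σ (λ i → f (y * element i))
    sum-scale f f-cong {y} y≉0 with inverse y y≉0
    ... | z , yz≈1 = sum-reindex f f-cong (y *_) (z *_) *-congˡ *-congˡ
      (λ x → trans (sym (*-assoc _ _ _)) (trans (*-congʳ yz≈1) (*-identityˡ x)))
      (λ x → trans (sym (*-assoc _ _ _)) (trans (*-congʳ (trans (*-comm z y) yz≈1)) (*-identityˡ x)))

  -- Translation by `1#` permutes the field, so adding `1#` to each of the `q` elements leaves their
  -- total unchanged.
  q·1≈0 : q · 1# ≈ 0#
  q·1≈0 = +-identityʳ-unique (sum element) (q · 1#) (begin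
    sum element + q · 1#                     ≈⟨ +-comm _ _ ⟩
    q · 1# + sum element                     ≈⟨ +-congʳ (sum-replicate q) ⟨
    sum {q} (λ _ → 1#) + sum element         ≈⟨ ∑-distrib-+ (λ _ → 1#) element ⟨
    sum (λ i → 1# + element i)               ≈⟨ sum-shift +-commutativeMonoid (λ x → x) (λ x≈y → x≈y) 1# ⟨
    sum element                              ∎)

  private
    module Π where
      open import Algebra.Properties.CommutativeMonoid.Sum *-commutativeMonoid public
      open SumProperties *-commutativeMonoid public

    product≉0 : ∀ {n} (f : Fin n → Carrier) → (∀ i → ¬ (f i ≈ 0#)) → ¬ (Π.sum f ≈ 0#)
    product≉0 {zero}  f f≉0 1≈0 = 0≉1 (sym 1≈0)
    product≉0 {suc n} f f≉0 Π≈0 = product≉0 (λ i → f (suc i)) (λ i → f≉0 (suc i)) (*-cancelˡ-≉0 (f≉0 zero) Π≈0)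

    if0 : Carrier → Carrier → Carrier → Carrier
    if0 a b y with y ≟ 0#
    ... | yes _ = a
    ... | no  _ = b

    if0-≈0 : ∀ {a b y} → y ≈ 0# → if0 a b y ≈ a
    if0-≈0 {y = y} y≈0 with y ≟ 0#
    ... | yes _   = refl
    ... | no  y≉0 = contradiction y≈0 y≉0

    if0-≉0 : ∀ {a b y} → ¬ (y ≈ 0#) → if0 a b y ≈ b
    if0-≉0 {y = y} y≉0 with y ≟ 0#
    ... | yes y≈0 = contradiction y≈0 y≉0
    ... | no  _   = refl

    -- The identity with the value at zero replaced by `1#`. The product of `g` over the whole
    -- enumeration is thus the product of the nonzero elements, without enumerating these
    -- separately.
    g : Carrier → Carrier
    g y = if0 1# y y

    g≉0 : ∀ y → ¬ (g y ≈ 0#)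
    g≉0 y eq with y ≟ 0#
    ... | yes _   = 0≉1 (sym eq)
    ... | no  y≉0 = y≉0 eq

    g-cong : ∀ {x y} → x ≈ y → g x ≈ g y
    g-cong {x} {y} x≈y with x ≟ 0#
    ... | yes x≈0 = sym (if0-≈0 (trans (sym x≈y) x≈0))
    ... | no  x≉0 = trans x≈y (sym (if0-≉0 (λ y≈0 → x≉0 (trans x≈y y≈0))))

    g-* : ∀ {x} → ¬ (x ≈ 0#) → ∀ y → g (x * y) ≈ if0 1# x y * g y
    g-* {x} x≉0 y with y ≟ 0#
    ... | yes y≈0 = trans (if0-≈0 (trans (*-congˡ y≈0) (zeroʳ x))) (sym (*-identityˡ 1#))
    ... | no  y≉0 = if0-≉0 (λ xy≈0 → y≉0 (*-cancelˡ-≉0 x≉0 xy≈0))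

    -- Multiplication by `x` permutes the field and multiplies the product of the nonzero elements
    -- by one factor `x` for each of them. Those q - 1 factors, collected in `h`, therefore have
    -- product 1, and of x^q only the factor at the index of zero remains.
    ^q-≉0 : ∀ {x} → ¬ (x ≈ 0#) → x ^ q ≈ x
    ^q-≉0 {x} x≉0 = begin
      x ^ q                                                  ≈⟨ Π.sum-replicate q ⟨
      Π.sum {q} (λ _ → x)                                    ≈⟨ Π.sum-cong-≋ (λ i → split (element i)) ⟩
      Π.sum (λ i → if0 x 1# (element i) * h i)               ≈⟨ Π.∑-distrib-+ (λ i → if0 x 1# (element i)) h ⟩
      Π.sum (λ i → if0 x 1# (element i)) * Π.sum h           ≈⟨ *-cong (Π.sum-single _ (index 0#) only-0) Πh≈1 ⟩
      if0 x 1# (element (index 0#)) * 1#                     ≈⟨ *-identityʳ _ ⟩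
      if0 x 1# (element (index 0#))                          ≈⟨ if0-≈0 (element-index 0#) ⟩
      x                                                      ∎
      where
      h : Fin q → Carrier
      h i = if0 1# x (element i)
      Πg = Π.sum (λ i → g (element i))
      split : ∀ y → x ≈ if0 x 1# y * if0 1# x y
      split y with y ≟ 0#
      ... | yes _ = sym (*-identityʳ x)
      ... | no  _ = sym (*-identityˡ x)
      only-0 : ∀ j → j ≢ index 0# → if0 x 1# (element j) ≈ 1#
      only-0 j j≢ = if0-≉0 (λ e≈0 → j≢ (element-injective (trans e≈0 (sym (element-index 0#)))))
      Πh*Πg : Π.sum h * Πg ≈ Πg
      Πh*Πg = begin
        Π.sum h * Πg                          ≈⟨ Π.∑-distrib-+ h (λ i → g (element i)) ⟨
        Π.sum (λ i → h i * g (element i))     ≈⟨ Π.sum-cong-≋ (λ i → g-* x≉0 (element i)) ⟨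
        Π.sum (λ i → g (x * element i))       ≈⟨ sum-scale *-commutativeMonoid g g-cong x≉0 ⟨
        Πg                                    ∎
      Πh≈1 : Π.sum h ≈ 1#
      Πh≈1 = x∙y⁻¹≈ε⇒x≈y _ _ (*-cancelˡ-≉0 (product≉0 (λ i → g (element i)) (λ i → g≉0 (element i))) (begin
        Πg * (Π.sum h - 1#)     ≈⟨ solve 2 (λ a b → a :* (b :- #1) := b :* a :- a) refl Πg (Π.sum h) ⟩
        Π.sum h * Πg - Πg       ≈⟨ +-congʳ Πh*Πg ⟩
        Πg - Πg                 ≈⟨ -‿inverseʳ Πg ⟩
        0#                      ∎))

    -- The index serves as a witness that `q` is a successor, so that the power really contains a
    -- factor `x`.
    0^ : ∀ {q} → Fin q → ∀ {x} → x ≈ 0# → x ^ q ≈ x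
    0^ {suc q} _ x≈0 = trans (*-congʳ x≈0) (trans (zeroˡ _) (sym x≈0))

  x^q≈x : ∀ x → x ^ q ≈ x
  x^q≈x x with x ≟ 0#
  ... | yes x≈0 = 0^ (index 0#) x≈0
  ... | no  x≉0 = ^q-≉0 x≉0

  -- f is a polynomial function of degree at most d, and c its coefficient of degree d.
  IsPoly : ℕ → Carrier → (Carrier → Carrier) → Set _
  IsPoly zero    c f = ∀ x → f x ≈ c
  IsPoly (suc d) c f = ∃ λ a → ∃ λ g → IsPoly d c g × (∀ x → f x ≈ a + x * g x)

  IsPoly-resp : ∀ d {c c′ f f′} → c ≈ c′ → (∀ x → f x ≈ f′ x) → IsPoly d c f → IsPoly d c′ f′
  IsPoly-resp zero    c≈ f≈ pf           = λ x → trans (sym (f≈ x)) (trans (pf x) c≈)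
  IsPoly-resp (suc d) c≈ f≈ (a , g , pg , eq) =
    a , g , IsPoly-resp d c≈ (λ _ → refl) pg , λ x → trans (sym (f≈ x)) (eq x)

  IsPoly-+ : ∀ d {c c′ f f′} → IsPoly d c f → IsPoly d c′ f′ → IsPoly d (c + c′) (λ x → f x + f′ x)
  IsPoly-+ zero    pf pf′ x = +-cong (pf x) (pf′ x)
  IsPoly-+ (suc d) (a , g , pg , eq) (a′ , g′ , pg′ , eq′) =
    a + a′ , (λ x → g x + g′ x) , IsPoly-+ d pg pg′ , λ x → trans (+-cong (eq x) (eq′ x))
      (solve 5 (λ x a b g h → (a :+ x :* g) :+ (b :+ x :* h) := (a :+ b) :+ x :* (g :+ h)) refl x a a′ (g x) (g′ x))

  IsPoly-* : ∀ d r {c f} → IsPoly d c f → IsPoly d (r * c) (λ x → r * f x)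
  IsPoly-* zero    r pf x = *-congˡ (pf x)
  IsPoly-* (suc d) r (a , g , pg , eq) =
    r * a , (λ x → r * g x) , IsPoly-* d r pg , λ x → trans (*-congˡ (eq x))
      (solve 4 (λ r a x g → r :* (a :+ x :* g) := r :* a :+ x :* (r :* g)) refl r a x (g x))

  IsPoly-suc : ∀ d {c f} → IsPoly d c f → IsPoly (suc d) 0# f
  IsPoly-suc zero    {c} pf = c , (λ _ → 0#) , (λ _ → refl) , λ x →
    trans (pf x) (sym (trans (+-congˡ (zeroʳ x)) (+-identityʳ c)))
  IsPoly-suc (suc d) (a , g , pg , eq) = a , g , IsPoly-suc d pg , eq

  IsPoly-< : ∀ {d e c f} → d ℕ.<′ e → IsPoly d c f → IsPoly e 0# f
  IsPoly-< {d} (ℕ.≤′-reflexive ≡.refl) pf = IsPoly-suc d pf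
  IsPoly-< {e = suc e} (ℕ.≤′-step d<e) pf = IsPoly-suc e (IsPoly-< d<e pf)

  IsPoly-^ : ∀ k → IsPoly k 1# (_^ k)
  IsPoly-^ zero    x = refl
  IsPoly-^ (suc k) = 0# , (_^ k) , IsPoly-^ k , λ x → sym (+-identityˡ _)

  -- Synthetic division by X - r. The quotient keeps the leading coefficient `c`, which is what
  -- `tooManyRoots` carries down to degree zero.
  factor : ∀ d {c f} → IsPoly (suc d) c f → ∀ r →
           ∃ λ h → IsPoly d c h × (∀ x → f x - f r ≈ (x - r) * h x)
  factor zero {f = f} (a , g , pg , eq) r = g , pg , λ x → begin
    f x - f r                          ≈⟨ +-cong (eq x) (-‿cong (trans (eq r) (+-congˡ (*-congˡ (trans (pg r) (sym (pg x))))))) ⟩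
    (a + x * g x) - (a + r * g x)      ≈⟨ solve 4 (λ a x r g → (a :+ x :* g) :- (a :+ r :* g) := (x :- r) :* g) refl a x r (g x) ⟩
    (x - r) * g x                      ∎
  factor (suc d) {f = f} (a , g , pg , eq) r with factor d pg r
  ... | h , ph , gx-gr = (λ x → g x + r * h x) ,
    IsPoly-resp (suc d) (+-identityʳ _) (λ _ → refl) (IsPoly-+ (suc d) pg (IsPoly-suc d (IsPoly-* d r ph))) , λ x → begin
    f x - f r                               ≈⟨ +-cong (eq x) (-‿cong (eq r)) ⟩
    (a + x * g x) - (a + r * g r)           ≈⟨ solve 5 (λ a x r u v → (a :+ x :* u) :- (a :+ r :* v) := (x :- r) :* u :+ r :* (u :- v)) refl a x r (g x) (g r) ⟩
    (x - r) * g x + r * (g x - g r)         ≈⟨ +-congˡ (*-congˡ (gx-gr x)) ⟩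
    (x - r) * g x + r * ((x - r) * h x)     ≈⟨ solve 4 (λ x r u h → (x :- r) :* u :+ r :* ((x :- r) :* h) := (x :- r) :* (u :+ r :* h)) refl x r (g x) (h x) ⟩
    (x - r) * (g x + r * h x)               ∎

  -- Dividing out the first root leaves the others as roots of the quotient, since differences of
  -- distinct roots cancel. The conclusion concerns the coefficient, so for a monic polynomial
  -- function it reads 1 = 0.
  tooManyRoots : ∀ d {c f} → IsPoly d c f → (ρ : Fin (suc d) → Carrier) → (∀ {i j} → ρ i ≈ ρ j → i ≡ j) →
                 (∀ i → f (ρ i) ≈ 0#) → c ≈ 0#
  tooManyRoots zero    pf ρ ρ-inj root = trans (sym (pf (ρ zero))) (root zero)
  tooManyRoots (suc d) {f = f} pf ρ ρ-inj root with factor d pf (ρ zero)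
  ... | h , ph , eq = tooManyRoots d ph (λ i → ρ (suc i)) (λ e → Fin.suc-injective (ρ-inj e)) λ i →
    *-cancelˡ-≉0 (λ e → Fin.0≢1+n (≡.sym (ρ-inj (x∙y⁻¹≈ε⇒x≈y _ _ e)))) (begin
      (ρ (suc i) - ρ zero) * h (ρ (suc i))   ≈⟨ eq (ρ (suc i)) ⟨
      f (ρ (suc i)) - f (ρ zero)             ≈⟨ +-cong (root (suc i)) (-‿cong (root zero)) ⟩
      0# - 0#                                ≈⟨ -‿inverseʳ 0# ⟩
      0#                                     ∎)

-- Characteristic, Frobenius map and absolute trace.

module TraceProperties {c ℓ} {p} (p-prime : Prime p) (n : ℕ) (K : FiniteField c ℓ (p ℕ.^ n)) where
  open FiniteField K hiding (zero)
  open FiniteFieldProperties K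
  open AbsoluteTrace p n K
  open MonoidMultiples +-monoid
  open SumProperties +-commutativeMonoid
  open import Algebra.Properties.Group +-group using (∙-cancelˡ)
  open import Algebra.Properties.Semiring.Exp semiring using (^-congˡ; ^-congʳ; ^-assocʳ)
  open import Algebra.Properties.Semiring.Mult semiring using (×-homo-+; ×1-homo-*; ×-congˡ; ×-congʳ; ×-assoc-*; ×-homo-1)
  open import Algebra.Properties.Semiring.Sum semiring using (sum-cong-≋; ∑-distrib-+; sum-init-last)
  open import Algebra.Properties.CommutativeSemiring.Binomial commutativeSemiring using (binomialTerm) renaming (theorem to binomialTheorem)
  open IntegerSolver commutativeRing
  open SetoidReasoning setoid

  n≢0 : n ≢ 0
  n≢0 ≡.refl = 0≉1 (trans (sym (element-index 0#))
    (trans (reflexive (≡.cong element (Fin1 (index 0#) (index 1#)))) (element-index 1#)))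
    where
    Fin1 : (i j : Fin 1) → i ≡ j
    Fin1 zero zero = ≡.refl

  -- The cardinality p^n annihilates 1, and (p^n) · 1 is the n-th power of p · 1. A field has no
  -- nilpotent elements besides zero.
  p·1≈0 : p · 1# ≈ 0#
  p·1≈0 = ^≈0⇒≈0 n (trans (sym (·1-^ n)) q·1≈0)
    where
    ·1-^ : ∀ k → (p ℕ.^ k) · 1# ≈ (p · 1#) ^ k
    ·1-^ zero    = ×-homo-1 1#
    ·1-^ (suc k) = trans (×1-homo-* p (p ℕ.^ k)) (*-congˡ (·1-^ k))

  ∣⇒·≈0 : ∀ {m} x → p ∣ m → m · x ≈ 0#
  ∣⇒·≈0 {m} x p∣m = begin
    m · x           ≈⟨ ×-congʳ m (*-identityˡ x) ⟨
    m · (1# * x)    ≈⟨ ×-assoc-* m 1# x ⟨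
    m · 1# * x      ≈⟨ *-congʳ (∣⇒·≈ε p∣m p·1≈0) ⟩
    0# * x          ≈⟨ zeroˡ x ⟩
    0#              ∎

  ·1≈0⇒∣ : ∀ m → m · 1# ≈ 0# → p ∣ m
  ·1≈0⇒∣ m m·1≈0 = decidable-stable (p ∣? m) λ p∤m →
    0≉1 (sym (coprime-·≈ε (prime∤⇒coprime p-prime p∤m) m·1≈0 p·1≈0))

  +-cancel-·1 : ∀ k d → k · 1# ≈ (k ℕ.+ d) · 1# → d · 1# ≈ 0#
  +-cancel-·1 k d eq = ∙-cancelˡ (k · 1#) _ _
    (trans (sym (×-homo-+ 1# k d)) (trans (sym eq) (sym (+-identityʳ _))))

  ·1-injective : ∀ {i j : Fin p} → toℕ i · 1# ≈ toℕ j · 1# → i ≡ j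
  ·1-injective {i} {j} eq = Fin.toℕ-injective (ℕ.≤-antisym
      (ℕ.≮⇒≥ (λ j<i → lem (Fin.toℕ<n i) j<i (sym eq))) (ℕ.≮⇒≥ (λ i<j → lem (Fin.toℕ<n j) i<j eq)))
    where
    lem : ∀ {k l} → l ℕ.< p → k ℕ.< l → ¬ (k · 1# ≈ l · 1#)
    lem {k} l<p k<l eq with ℕ.m≤n⇒∃[o]m+o≡n k<l
    ... | d , ≡.refl = ℕ.<⇒≱ (ℕ.≤-<-trans (ℕ.s≤s (ℕ.m≤n+m d k)) l<p)
      (∣⇒≤ (·1≈0⇒∣ (suc d) (+-cancel-·1 k (suc d) (trans eq (×-congˡ (≡.sym (ℕ.+-suc k d)))))))

  frobenius-+ : ∀ x y → (x + y) ^ p ≈ x ^ p + y ^ p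
  frobenius-+ x y = trans (binomialTheorem p x y) (lem p p-prime ∣⇒·≈0)
    where
    -- The outer `p` is fixed together with the field and cannot be split into a successor. It is
    -- generalised here, keeping only the vanishing of its multiples.
    lem : ∀ p → Prime p → (∀ {m} x → p ∣ m → m · x ≈ 0#) → sum (binomialTerm x y p) ≈ x ^ p + y ^ p
    lem zero    p-prime _ = contradiction p-prime ¬prime[0]
    lem (suc p) p-prime ∣⇒·≈0 = begin
      t zero + sum (λ i → t (suc i))    ≈⟨ +-cong first (sum-single (λ i → t (suc i)) (Fin.fromℕ p) middle) ⟩
      y ^ suc p + t (suc (Fin.fromℕ p))     ≈⟨ +-congˡ last ⟩
      y ^ suc p + x ^ suc p             ≈⟨ +-comm _ _ ⟩
      x ^ suc p + y ^ suc p             ∎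
      where
      t = binomialTerm x y (suc p)
      first : t zero ≈ y ^ suc p
      first = trans (×-homo-1 _) (*-identityˡ _)
      last : t (suc (Fin.fromℕ p)) ≈ x ^ suc p
      last rewrite Fin.toℕ-fromℕ p | nCn≡1 (suc p) | ℕ.n∸n≡0 p = trans (×-homo-1 _) (*-identityʳ _)
      middle : ∀ i → i ≢ Fin.fromℕ p → t (suc i) ≈ 0#
      middle i i≢p = ∣⇒·≈0 _ (prime∣binomial p-prime (ℕ.s≤s ℕ.z≤n) (ℕ.s≤s (ℕ.≤∧≢⇒<
        (ℕ.s≤s⁻¹ (Fin.toℕ<n i)) (λ e → i≢p (Fin.toℕ-injective (≡.trans e (≡.sym (Fin.toℕ-fromℕ p))))))))

  frobenius-0 : 0# ^ p ≈ 0#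
  frobenius-0 = ∙-cancelˡ (0# ^ p) _ _ (trans (sym (frobenius-+ 0# 0#))
    (trans (^-congˡ p (+-identityˡ 0#)) (sym (+-identityʳ _))))

  1^ : ∀ k → 1# ^ k ≈ 1#
  1^ zero    = refl
  1^ (suc k) = trans (*-identityˡ _) (1^ k)

  frobenius-·1 : ∀ k → (k · 1#) ^ p ≈ k · 1#
  frobenius-·1 zero    = frobenius-0
  frobenius-·1 (suc k) = trans (frobenius-+ 1# (k · 1#)) (+-cong (1^ p) (frobenius-·1 k))

  frobenius-sum : ∀ {k} (f : Fin k → Carrier) → sum f ^ p ≈ sum (λ i → f i ^ p)
  frobenius-sum {zero}  f = frobenius-0
  frobenius-sum {suc k} f = trans (frobenius-+ _ _) (+-congˡ (frobenius-sum (λ i → f (suc i))))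

  ^-suc : ∀ x i → x ^ (p ℕ.^ suc i) ≈ (x ^ (p ℕ.^ i)) ^ p
  ^-suc x i = trans (^-congʳ x (ℕ.*-comm p (p ℕ.^ i))) (sym (^-assocʳ x (p ℕ.^ i) p))

  frobenius^-+ : ∀ i x y → (x + y) ^ (p ℕ.^ i) ≈ x ^ (p ℕ.^ i) + y ^ (p ℕ.^ i)
  frobenius^-+ zero    x y = trans (*-identityʳ _) (+-cong (sym (*-identityʳ _)) (sym (*-identityʳ _)))
  frobenius^-+ (suc i) x y = begin
    (x + y) ^ (p ℕ.^ suc i)                        ≈⟨ ^-suc (x + y) i ⟩
    ((x + y) ^ (p ℕ.^ i)) ^ p                      ≈⟨ ^-congˡ p (frobenius^-+ i x y) ⟩
    (x ^ (p ℕ.^ i) + y ^ (p ℕ.^ i)) ^ p            ≈⟨ frobenius-+ _ _ ⟩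
    (x ^ (p ℕ.^ i)) ^ p + (y ^ (p ℕ.^ i)) ^ p      ≈⟨ +-cong (^-suc x i) (^-suc y i) ⟨
    x ^ (p ℕ.^ suc i) + y ^ (p ℕ.^ suc i)          ∎

  trace-cong : ∀ {x y} → x ≈ y → trace x ≈ trace y
  trace-cong x≈y = sum-cong-≋ {n} (λ i → ^-congˡ (p ℕ.^ toℕ i) x≈y)

  trace-+ : ∀ x y → trace (x + y) ≈ trace x + trace y
  trace-+ x y = trans (sum-cong-≋ {n} (λ i → frobenius^-+ (toℕ i) x y))
                      (∑-distrib-+ {n} (λ i → x ^ (p ℕ.^ toℕ i)) (λ i → y ^ (p ℕ.^ toℕ i)))

  -- The Frobenius map shifts the exponents p^i by one. With `x` added in front, both sides become
  -- the sum of x^(p^i) for i from 0 to n, whose last term x^(p^n) is again `x`.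
  frobenius-trace : ∀ x → trace x ^ p ≈ trace x
  frobenius-trace x = ∙-cancelˡ x _ _ (begin
    x + trace x ^ p                                      ≈⟨ +-cong (sym (*-identityʳ x)) (frobenius-sum {n} (λ i → x ^ (p ℕ.^ toℕ i))) ⟩
    t {suc n} zero + sum {n} (λ i → t i ^ p)             ≈⟨ +-congˡ (sum-cong-≋ {n} (λ i → sym (^-suc x (toℕ i)))) ⟩
    sum {suc n} t                                        ≈⟨ sum-init-last {n} t ⟩
    sum {n} (λ i → t (inject₁ i)) + t (Fin.fromℕ n)          ≈⟨ +-cong (sum-cong-≋ {n} (λ i → ^-congʳ x (≡.cong (p ℕ.^_) (Fin.toℕ-inject₁ i))))
                                                                   (^-congʳ x (≡.cong (p ℕ.^_) (Fin.toℕ-fromℕ n))) ⟩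
    trace x + x ^ (p ℕ.^ n)                              ≈⟨ +-congˡ (x^q≈x x) ⟩
    trace x + x                                          ≈⟨ +-comm _ _ ⟩
    x + trace x                                          ∎)
    where
    t : ∀ {k} → Fin k → Carrier
    t i = x ^ (p ℕ.^ toℕ i)

  1<p : 1 ℕ.< p
  1<p = ℕ.nonTrivial⇒n>1 p {{prime⇒nonTrivial p-prime}}

  -- X^p - X has no root besides the p elements k · 1.
  fixed⇒prime-field : ∀ y → y ^ p ≈ y → ∃ λ (k : Fin p) → toℕ k · 1# ≈ y
  fixed⇒prime-field y y^p≈y = decidable-stable (Fin.any? (λ (k : Fin p) → (toℕ k · 1#) ≟ y)) λ y∉𝔽ₚ →
    0≉1 (sym (tooManyRoots p poly (ρ y) (ρ-injective y∉𝔽ₚ) root))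
    where
    ρ : Carrier → Fin (suc p) → Carrier
    ρ y zero    = y
    ρ y (suc k) = toℕ k · 1#
    ρ-injective : ¬ (∃ λ (k : Fin p) → toℕ k · 1# ≈ y) → ∀ {i j} → ρ y i ≈ ρ y j → i ≡ j
    ρ-injective y∉𝔽ₚ {zero}  {zero}  _  = ≡.refl
    ρ-injective y∉𝔽ₚ {zero}  {suc j} eq = contradiction (j , sym eq) y∉𝔽ₚ
    ρ-injective y∉𝔽ₚ {suc i} {zero}  eq = contradiction (i , eq) y∉𝔽ₚ
    ρ-injective y∉𝔽ₚ {suc i} {suc j} eq = ≡.cong suc (·1-injective eq)
    poly : IsPoly p 1# (λ x → x ^ p + - 1# * x)
    poly = IsPoly-resp p (+-identityʳ 1#) (λ x → +-congˡ (*-congˡ (*-identityʳ x)))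
      (IsPoly-+ p (IsPoly-^ p) (IsPoly-< (ℕ.≤⇒≤′ 1<p) (IsPoly-* 1 (- 1#) (IsPoly-^ 1))))
    root : ∀ i → ρ y i ^ p + - 1# * ρ y i ≈ 0#
    root i = trans (+-congʳ (fixed i)) (solve 1 (λ x → x :+ :- #1 :* x := #0) refl (ρ y i))
      where
      fixed : ∀ i → ρ y i ^ p ≈ ρ y i
      fixed zero    = y^p≈y
      fixed (suc k) = frobenius-·1 (toℕ k)

  residue-spec : ∀ {y} → (∃ λ (k : Fin p) → toℕ k · 1# ≈ y) → residue y · 1# ≈ y
  residue-spec {y} k·1≈y with Fin.any? {n = p} (λ k → (toℕ k · 1#) ≟ y)
  ... | yes (_ , eq) = eq
  ... | no ∄k        = contradiction k·1≈y ∄k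

  Tr-spec : ∀ x → Tr x · 1# ≈ trace x
  Tr-spec x = residue-spec (fixed⇒prime-field (trace x) (frobenius-trace x))

  Tr≤p : ∀ x → Tr x ℕ.≤ p
  Tr≤p x with Fin.any? {n = p} (λ k → (toℕ k · 1#) ≟ trace x)
  ... | yes (k , _) = ℕ.<⇒≤ (Fin.toℕ<n k)
  ... | no _        = ℕ.z≤n

  -- As a polynomial function the trace is monic of degree p^(n-1), because its other exponents are
  -- smaller powers of `p`. Vanishing everywhere would give it too many roots.
  trace-nonzero : ¬ (∀ x → trace x ≈ 0#)
  trace-nonzero trace≈0 = lem n ≡.refl
    where
    e-< : ∀ k → p ℕ.^ k ℕ.< p ℕ.^ suc k
    e-< k = ℕ.^-monoʳ-< p 1<p (ℕ.n<1+n k)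
    poly : ∀ k → IsPoly (p ℕ.^ k) 1# (λ x → sum {suc k} (λ i → x ^ (p ℕ.^ toℕ i)))
    poly zero    = IsPoly-resp 1 refl (λ x → sym (+-identityʳ _)) (IsPoly-^ 1)
    poly (suc k) = IsPoly-resp (p ℕ.^ suc k) (+-identityˡ 1#)
      (λ x → sym (trans (sum-init-last {suc k} (λ i → x ^ (p ℕ.^ toℕ i)))
        (+-cong (sum-cong-≋ {suc k} (λ i → ^-congʳ x (≡.cong (p ℕ.^_) (Fin.toℕ-inject₁ i))))
                (^-congʳ x (≡.cong (p ℕ.^_) (Fin.toℕ-fromℕ (suc k)))))))
      (IsPoly-+ (p ℕ.^ suc k) (IsPoly-< (ℕ.≤⇒≤′ (e-< k)) (poly k)) (IsPoly-^ (p ℕ.^ suc k)))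
    lem : ∀ k → k ≡ n → _
    lem zero    0≡n    = n≢0 (≡.sym 0≡n)
    -- The strict inequality of `e-<` unfolds to 1 + p^k ≤ p^(k+1). It embeds the required 1 + p^k
    -- indices into the enumeration of the field.
    lem (suc k) ≡.refl = 0≉1 (sym (tooManyRoots (p ℕ.^ k) (poly k) (λ i → element (Fin.inject≤ i (e-< k)))
      (λ eq → Fin.inject≤-injective _ _ _ _ (element-injective eq)) (λ i → trace≈0 _)))

-- Roots of unity in a commutative ring.

module _ {c ℓ} (C : CommutativeRing c ℓ) where
  open CommutativeRing C
  open import Algebra.Properties.Semiring.Exp semiring using (_^_)

  -- fixed⇒≈0 says that ζ ^ k - 1 is a non-zero-divisor; no inverse is available without deciding equality.
  record RootOfUnity (p : ℕ) : Set (c ⊔ ℓ) where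
    field
      ζ ζ⁻¹     : Carrier
      ζ*ζ⁻¹≈1   : ζ * ζ⁻¹ ≈ 1#
      ζ^p≈1     : ζ ^ p ≈ 1#
      fixed⇒≈0  : ∀ k {s} → p ∤ k → ζ ^ k * s ≈ s → s ≈ 0#

-- Counting in vectors.

module _ {a p} {A : Set a} {P : Pred A p} (P? : Decidable P) where
  count-∷-yes : ∀ {n x} → P x → (xs : Vec A n) → count P? (x ∷ xs) ≡ suc (count P? xs)
  count-∷-yes {x = x} px xs with P? x
  ... | yes _  = ≡.refl
  ... | no ¬px = contradiction px ¬px

  count-∷-no : ∀ {n x} → ¬ P x → (xs : Vec A n) → count P? (x ∷ xs) ≡ count P? xs
  count-∷-no {x = x} ¬px xs with P? x
  ... | yes px = contradiction px ¬px
  ... | no _   = ≡.refl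

count-cong : ∀ {a p q n} {A : Set a} {P : Pred A p} {Q : Pred A q} (P? : Decidable P) (Q? : Decidable Q) →
             (∀ {x} → P x → Q x) → (∀ {x} → Q x → P x) → (xs : Vec A n) → count P? xs ≡ count Q? xs
count-cong P? Q? P⇒Q Q⇒P []       = ≡.refl
count-cong P? Q? P⇒Q Q⇒P (x ∷ xs) with P? x | Q? x
... | yes _  | yes _  = ≡.cong suc (count-cong P? Q? P⇒Q Q⇒P xs)
... | no _   | no _   = count-cong P? Q? P⇒Q Q⇒P xs
... | yes px | no ¬qx = contradiction (P⇒Q px) ¬qx
... | no ¬px | yes qx = contradiction (Q⇒P qx) ¬px

-- Additive characters: orthogonality, Parseval's identity and sums over fibres.

module Characters {c ℓ a ℓa} (C : CommutativeRing c ℓ) {p} (p-prime : Prime p) (root : RootOfUnity C p)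
                  (n : ℕ) (K : FiniteField a ℓa (p ℕ.^ n)) where
  open CommutativeRing C hiding (zero)
  open RootOfUnity root
  private
    module K where
      open FiniteField K hiding (zero) public
      open FiniteFieldProperties K public
      open AbsoluteTrace p n K public
      open TraceProperties p-prime n K public
  open MonoidMultiples *-monoid
  open SumProperties +-commutativeMonoid
  open IntegerSolver C
  open import Algebra.Properties.Semiring.Exp semiring using (_^_; ^-homo-*)
  open import Algebra.Properties.CommutativeSemiring.Exp commutativeSemiring using (^-distrib-*)
  open import Algebra.Properties.Semiring.Mult semiring using (×-assocˡ; ×-assoc-*; ×-congʳ; ×-congˡ) renaming (_×_ to _·_)
  open import Algebra.Properties.Semiring.Sum semiring
    using (sum; sum-cong-≋; ∑-comm; ∑-distrib-+; sum-replicate; sum-replicate-zero; *-distribˡ-sum; *-distribʳ-sum)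
  open SetoidReasoning setoid

  χ χ⁻¹ : K.Carrier → Carrier
  χ x   = ζ ^ K.Tr x
  χ⁻¹ x = ζ⁻¹ ^ K.Tr x

  ζ^-inverse : ∀ k → ζ ^ k * ζ⁻¹ ^ k ≈ 1#
  ζ^-inverse k = trans (sym (^-distrib-* ζ ζ⁻¹ k)) (trans (×-congʳ* k ζ*ζ⁻¹≈1) (·-ε k))
    where open import Algebra.Properties.Monoid.Mult *-monoid using () renaming (×-congʳ to ×-congʳ*)

  -- The field has characteristic `p`, so equal images force `k` and `l` to differ by a multiple of
  -- `p`, and ζ^p = 1. This is how identities between traces become identities between powers of
  -- `ζ`.
  ζ^-cong : ∀ k l → k K.· K.1# K.≈ l K.· K.1# → ζ ^ k ≈ ζ ^ l
  ζ^-cong k l eq = [ (λ k≤l → lem k≤l eq) , (λ l≤k → sym (lem l≤k (K.sym eq))) ]′ (ℕ.≤-total k l)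
    where
    lem : ∀ {k l} → k ℕ.≤ l → k K.· K.1# K.≈ l K.· K.1# → ζ ^ k ≈ ζ ^ l
    lem {k} k≤l eq with ℕ.m≤n⇒∃[o]m+o≡n k≤l
    ... | d , ≡.refl = begin
      ζ ^ k            ≈⟨ *-identityʳ _ ⟨
      ζ ^ k * 1#       ≈⟨ *-congˡ (∣⇒·≈ε (K.·1≈0⇒∣ d (K.+-cancel-·1 k d eq)) ζ^p≈1) ⟨
      ζ ^ k * ζ ^ d    ≈⟨ ^-homo-* ζ k d ⟨
      ζ ^ (k ℕ.+ d)    ∎

  χ-cong : ∀ {x y} → x K.≈ y → χ x ≈ χ y
  χ-cong {x} {y} x≈y = ζ^-cong (K.Tr x) (K.Tr y)
    (K.trans (K.Tr-spec x) (K.trans (K.trace-cong x≈y) (K.sym (K.Tr-spec y))))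

  χ-+ : ∀ x y → χ (x K.+ y) ≈ χ x * χ y
  χ-+ x y = trans (ζ^-cong (K.Tr (x K.+ y)) (K.Tr x ℕ.+ K.Tr y)
      (K.trans (K.Tr-spec (x K.+ y)) (K.trans (K.trace-+ x y)
        (K.trans (K.+-cong (K.sym (K.Tr-spec x)) (K.sym (K.Tr-spec y))) (K.sym (×-homo-+ K.1# (K.Tr x) (K.Tr y)))))))
    (^-homo-* ζ (K.Tr x) (K.Tr y))
    where open import Algebra.Properties.Monoid.Mult K.+-monoid using (×-homo-+)

  χ-inverse : ∀ x → χ x * χ⁻¹ x ≈ 1#
  χ-inverse x = ζ^-inverse (K.Tr x)

  χ⁻¹-unique : ∀ x {z} → χ x * z ≈ 1# → z ≈ χ⁻¹ x
  χ⁻¹-unique x {z} χz≈1 = begin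
    z                     ≈⟨ *-identityˡ z ⟨
    1# * z                ≈⟨ *-congʳ (χ-inverse x) ⟨
    χ x * χ⁻¹ x * z       ≈⟨ solve 3 (λ u v z → u :* v :* z := u :* z :* v) refl (χ x) (χ⁻¹ x) z ⟩
    χ x * z * χ⁻¹ x       ≈⟨ *-congʳ χz≈1 ⟩
    1# * χ⁻¹ x            ≈⟨ *-identityˡ _ ⟩
    χ⁻¹ x                 ∎

  χ⁻¹-cong : ∀ {x y} → x K.≈ y → χ⁻¹ x ≈ χ⁻¹ y
  χ⁻¹-cong {x} {y} x≈y = χ⁻¹-unique y (trans (*-congʳ (χ-cong (K.sym x≈y))) (χ-inverse x))

  χ-≈0 : ∀ {x} → x K.≈ K.0# → χ x ≈ 1#
  χ-≈0 {x} x≈0 = begin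
    χ x                        ≈⟨ *-identityʳ _ ⟨
    χ x * 1#                   ≈⟨ *-congˡ (χ-inverse x) ⟨
    χ x * (χ x * χ⁻¹ x)        ≈⟨ *-assoc _ _ _ ⟨
    χ x * χ x * χ⁻¹ x          ≈⟨ *-congʳ (χ-+ x x) ⟨
    χ (x K.+ x) * χ⁻¹ x        ≈⟨ *-congʳ (χ-cong (K.trans (K.+-congˡ x≈0) (K.+-identityʳ x))) ⟩
    χ x * χ⁻¹ x                ≈⟨ χ-inverse x ⟩
    1#                         ∎

  χ⁻¹-≈0 : ∀ {x} → x K.≈ K.0# → χ⁻¹ x ≈ 1#
  χ⁻¹-≈0 {x} x≈0 = sym (χ⁻¹-unique x (trans (*-identityʳ _) (χ-≈0 x≈0)))

  χ-sub : ∀ x y → χ⁻¹ x * χ y ≈ χ (y K.- x)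
  χ-sub x y = begin
    χ⁻¹ x * χ y                       ≈⟨ *-congˡ (χ-cong y≈) ⟩
    χ⁻¹ x * χ (x K.+ (y K.- x))       ≈⟨ *-congˡ (χ-+ x (y K.- x)) ⟩
    χ⁻¹ x * (χ x * χ (y K.- x))       ≈⟨ solve 3 (λ u v z → v :* (u :* z) := u :* v :* z) refl (χ x) (χ⁻¹ x) _ ⟩
    χ x * χ⁻¹ x * χ (y K.- x)         ≈⟨ *-congʳ (χ-inverse x) ⟩
    1# * χ (y K.- x)                  ≈⟨ *-identityˡ _ ⟩
    χ (y K.- x)                       ∎
    where
    module S = IntegerSolver K.commutativeRing
    y≈ : y K.≈ x K.+ (y K.- x)
    y≈ = S.solve 2 (λ x y → y S.:= x S.:+ (y S.:- x)) K.refl x y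

  -- A finite search finds an element `y` of nonzero trace. Translation by `y` preserves the sum and
  -- also multiplies it by `χ y`, whose exponent is prime to `p`, so `fixed⇒≈0` applies.
  ∑χ≈0 : sum (λ i → χ (K.element i)) ≈ 0#
  ∑χ≈0 with Fin.¬∀⟶∃¬ _ (λ i → K.trace (K.element i) K.≈ K.0#) (λ i → K.trace (K.element i) K.≟ K.0#)
              (λ all → K.trace-nonzero (λ x → K.trans (K.trace-cong (K.sym (K.element-index x))) (all (K.index x))))
  ... | i , trace≉0 = fixed⇒≈0 (K.Tr y) p∤Tr (begin
    χ y * sum (λ j → χ (K.element j))      ≈⟨ *-distribˡ-sum (χ y) (λ j → χ (K.element j)) ⟩
    sum (λ j → χ y * χ (K.element j))      ≈⟨ sum-cong-≋ (λ j → χ-+ y (K.element j)) ⟨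
    sum (λ j → χ (y K.+ K.element j))      ≈⟨ K.sum-shift +-commutativeMonoid χ χ-cong y ⟨
    sum (λ j → χ (K.element j))            ∎)
    where
    y = K.element i
    p∤Tr : p ∤ K.Tr y
    p∤Tr p∣Tr = trace≉0 (K.trans (K.sym (K.Tr-spec y)) (K.∣⇒·≈0 K.1# p∣Tr))

  ∑χ[x*]≈0 : ∀ {x} → ¬ (x K.≈ K.0#) → sum (λ i → χ (x K.* K.element i)) ≈ 0#
  ∑χ[x*]≈0 x≉0 = trans (sym (K.sum-scale +-commutativeMonoid χ χ-cong x≉0)) ∑χ≈0

  private
    q = p ℕ.^ n

  module _ (g g⁻¹ : Fin q → Carrier) (g-inverse : ∀ i → g i * g⁻¹ i ≈ 1#) where

    -- The second transform takes the place of the complex conjugate of the first: when the values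
    -- of `g` and `χ` have modulus 1, inverting them is conjugating them. Parseval's identity thus
    -- makes sense in a ring without conjugation.
    transform transform⁻¹ : K.Carrier → Carrier
    transform   y = sum (λ i → g i * χ⁻¹ (y K.* K.element i))
    transform⁻¹ y = sum (λ i → g⁻¹ i * χ (y K.* K.element i))

    private
      δ : Fin q → Fin q → Carrier
      δ i j = sum (λ k → χ (K.element k K.* (K.element j K.- K.element i)))

      δ-diagonal : ∀ i → δ i i ≈ q · 1#
      δ-diagonal i = trans (sum-cong-≋ {q} (λ k → χ-≈0 (K.trans (K.*-congˡ (K.-‿inverseʳ _)) (K.zeroʳ _)))) (sum-replicate q)

      δ-off-diagonal : ∀ i j → j ≢ i → δ i j ≈ 0#
      δ-off-diagonal i j j≢i = trans (sum-cong-≋ {q} (λ k → χ-cong (K.*-comm (K.element k) _)))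
        (∑χ[x*]≈0 (λ e → j≢i (K.element-injective (x∙y⁻¹≈ε⇒x≈y _ _ e))))
        where open import Algebra.Properties.Ring K.ring using (x∙y⁻¹≈ε⇒x≈y)

      expand : ∀ y → transform y * transform⁻¹ y ≈
               sum (λ i → sum (λ j → g i * g⁻¹ j * χ (y K.* (K.element j K.- K.element i))))
      expand y = begin
        transform y * transform⁻¹ y
          ≈⟨ *-distribʳ-sum (transform⁻¹ y) (λ i → g i * χ⁻¹ (y K.* K.element i)) ⟩
        sum (λ i → g i * χ⁻¹ (y K.* K.element i) * transform⁻¹ y)
          ≈⟨ sum-cong-≋ (λ i → *-distribˡ-sum (g i * χ⁻¹ (y K.* K.element i)) (λ j → g⁻¹ j * χ (y K.* K.element j))) ⟩
        sum (λ i → sum (λ j → g i * χ⁻¹ (y K.* K.element i) * (g⁻¹ j * χ (y K.* K.element j))))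
          ≈⟨ sum-cong-≋ (λ i → sum-cong-≋ (λ j → term i j)) ⟩
        sum (λ i → sum (λ j → g i * g⁻¹ j * χ (y K.* (K.element j K.- K.element i)))) ∎
        where
        module S = IntegerSolver K.commutativeRing
        term : ∀ i j → g i * χ⁻¹ (y K.* K.element i) * (g⁻¹ j * χ (y K.* K.element j)) ≈
                       g i * g⁻¹ j * χ (y K.* (K.element j K.- K.element i))
        term i j = trans
          (solve 4 (λ a b c d → a :* b :* (c :* d) := a :* c :* (b :* d)) refl (g i) _ (g⁻¹ j) _)
          (*-congˡ (trans (χ-sub _ _) (χ-cong
            (S.solve 3 (λ y u v → (y S.:* v) S.:- (y S.:* u) S.:= y S.:* (v S.:- u)) K.refl y (K.element i) (K.element j)))))

    -- With the sum over the frequency `k` moved innermost, orthogonality of characters leaves only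
    -- the diagonal i = j. Each of its `q` terms is `g i * g⁻¹ i` times `q`, which is `q`.
    parseval : sum (λ k → transform (K.element k) * transform⁻¹ (K.element k)) ≈ (q ℕ.* q) · 1#
    parseval = begin
      sum (λ k → transform (K.element k) * transform⁻¹ (K.element k))
        ≈⟨ sum-cong-≋ (λ k → expand (K.element k)) ⟩
      sum (λ k → sum (λ i → sum (λ j → t k i j)))
        ≈⟨ ∑-comm (λ k i → sum (λ j → t k i j)) ⟩
      sum (λ i → sum (λ k → sum (λ j → t k i j)))
        ≈⟨ sum-cong-≋ (λ i → ∑-comm (λ k j → t k i j)) ⟩
      sum (λ i → sum (λ j → sum (λ k → t k i j)))
        ≈⟨ sum-cong-≋ (λ i → sum-cong-≋ (λ j → sym (*-distribˡ-sum (g i * g⁻¹ j) (λ k → χ (K.element k K.* (K.element j K.- K.element i)))))) ⟩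
      sum (λ i → sum (λ j → g i * g⁻¹ j * δ i j))
        ≈⟨ sum-cong-≋ (λ i → sum-single (λ j → g i * g⁻¹ j * δ i j) i
             (λ j j≢i → trans (*-congˡ (δ-off-diagonal i j j≢i)) (zeroʳ _))) ⟩
      sum (λ i → g i * g⁻¹ i * δ i i)
        ≈⟨ sum-cong-≋ (λ i → trans (*-cong (g-inverse i) (δ-diagonal i)) (*-identityˡ _)) ⟩
      sum {q} (λ i → q · 1#)
        ≈⟨ sum-replicate q ⟩
      q · (q · 1#)
        ≈⟨ ×-assocˡ 1# q q ⟩
      (q ℕ.* q) · 1# ∎
      where
      t : Fin q → Fin q → Fin q → Carrier
      t k i j = g i * g⁻¹ j * χ (K.element k K.* (K.element j K.- K.element i))

  module _ {b} {A : Set b} (F : A → K.Carrier) where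
    -- Counting along an arbitrary family `f` permits induction on its length. For the enumeration
    -- of the domain this unfolds to `preimageSize`.
    fibreSize : ∀ {k} → (Fin k → A) → K.Carrier → ℕ
    fibreSize f y = count (λ x → F x K.≟ y) (tabulate f)

    fibreSize-cong : ∀ {k} (f : Fin k → A) {y z} → y K.≈ z → fibreSize f y ≡ fibreSize f z
    fibreSize-cong f {y} {z} y≈z = count-cong (λ x → F x K.≟ y) (λ x → F x K.≟ z)
      (λ e → K.trans e y≈z) (λ e → K.trans e (K.sym y≈z)) (tabulate f)

    private
      indicator : ∀ {p} {P : Set p} → Dec P → Carrier → Carrier
      indicator (yes _) s = s
      indicator (no _)  s = 0#

      indicator-yes : ∀ {p} {P : Set p} (P? : Dec P) {s} → P → indicator P? s ≈ s
      indicator-yes (yes _) p = refl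
      indicator-yes (no ¬p) p = contradiction p ¬p

      indicator-no : ∀ {p} {P : Set p} (P? : Dec P) {s} → ¬ P → indicator P? s ≈ 0#
      indicator-no (yes p) ¬p = contradiction p ¬p
      indicator-no (no _)  ¬p = refl

    -- Induction on the number of points: one more point enlarges exactly one fibre, the one over
    -- its image, and `hit` records the summand gained there.
    sum-fibres : ∀ {k} (f : Fin k → A) (h : K.Carrier → Carrier) → (∀ {x y} → x K.≈ y → h x ≈ h y) →
                 sum (λ i → h (F (f i))) ≈ sum (λ j → fibreSize f (K.element j) · h (K.element j))
    sum-fibres {zero}  f h h-cong = sym (sum-replicate-zero q)
    sum-fibres {suc k} f h h-cong = begin
      h (F (f zero)) + sum (λ i → h (F (f (suc i))))
        ≈⟨ +-cong (sym new) (sum-fibres (λ i → f (suc i)) h h-cong) ⟩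
      sum (λ j → hit (K.element j)) + sum (λ j → fibreSize (λ i → f (suc i)) (K.element j) · h (K.element j))
        ≈⟨ ∑-distrib-+ (λ j → hit (K.element j)) (λ j → fibreSize (λ i → f (suc i)) (K.element j) · h (K.element j)) ⟨
      sum (λ j → hit (K.element j) + fibreSize (λ i → f (suc i)) (K.element j) · h (K.element j))
        ≈⟨ sum-cong-≋ (λ j → step (K.element j)) ⟨
      sum (λ j → fibreSize f (K.element j) · h (K.element j)) ∎
      where
      hit : K.Carrier → Carrier
      hit y = indicator (F (f zero) K.≟ y) (h y)
      step : ∀ y → fibreSize f y · h y ≈ hit y + fibreSize (λ i → f (suc i)) y · h y
      step y = by-cases (F (f zero) K.≟ y)
        where
        by-cases : (d : Dec (F (f zero) K.≈ y)) → fibreSize f y · h y ≈ indicator d (h y) + fibreSize (λ i → f (suc i)) y · h y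
        by-cases (yes ≈y) = ×-congˡ (count-∷-yes (λ x → F x K.≟ y) ≈y (tabulate (λ i → f (suc i))))
        by-cases (no ≉y)  = trans (×-congˡ (count-∷-no (λ x → F x K.≟ y) ≉y (tabulate (λ i → f (suc i))))) (sym (+-identityˡ _))
      j₀ = K.index (F (f zero))
      F≈ : F (f zero) K.≈ K.element j₀
      F≈ = K.sym (K.element-index _)
      new : sum (λ j → hit (K.element j)) ≈ h (F (f zero))
      new = begin
        sum (λ j → hit (K.element j))  ≈⟨ sum-single (λ j → hit (K.element j)) j₀ (λ j j≢j₀ → indicator-no (F (f zero) K.≟ K.element j) (λ F≈j →
                                            j≢j₀ (K.element-injective (K.trans (K.sym F≈j) F≈)))) ⟩
        hit (K.element j₀)             ≈⟨ indicator-yes (F (f zero) K.≟ K.element j₀) F≈ ⟩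
        h (K.element j₀)               ≈⟨ h-cong F≈ ⟨
        h (F (f zero))                 ∎

    -- The common size `u` meets a vanishing character sum, and the excess `s` at zero is weighted
    -- by χ(0) = 1. Both are ring elements because the sizes are given by real expressions and the
    -- excess may be negative.
    ∑χ∘F : ∀ {k} (f : Fin k → A) {u s : Carrier} →
           fibreSize f K.0# · 1# ≈ u + s → (∀ {y} → ¬ (y K.≈ K.0#) → fibreSize f y · 1# ≈ u) →
           ∀ {x} → ¬ (x K.≈ K.0#) → sum (λ i → χ (x K.* F (f i))) ≈ s
    ∑χ∘F f {u} {s} size-0 size-≉0 {x} x≉0 = begin
      sum (λ i → χ (x K.* F (f i)))                          ≈⟨ sum-fibres f h (λ e → χ-cong (K.*-congˡ e)) ⟩
      sum (λ j → fibreSize f (K.element j) · h (K.element j)) ≈⟨ sum-cong-≋ (λ j → split (K.element j)) ⟩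
      sum (λ j → u * h (K.element j) + extra (K.element j))   ≈⟨ ∑-distrib-+ (λ j → u * h (K.element j)) (λ j → extra (K.element j)) ⟩
      sum (λ j → u * h (K.element j)) + sum (λ j → extra (K.element j))
        ≈⟨ +-cong (sym (*-distribˡ-sum u (λ j → h (K.element j)))) (sum-single (λ j → extra (K.element j)) (K.index K.0#)
             (λ j j≢ → indicator-no (K.element j K.≟ K.0#) (λ e → j≢ (K.element-injective (K.trans e (K.sym (K.element-index K.0#))))))) ⟩
      u * sum (λ j → h (K.element j)) + extra (K.element (K.index K.0#))
        ≈⟨ +-cong (*-congˡ (∑χ[x*]≈0 x≉0)) (indicator-yes (K.element (K.index K.0#) K.≟ K.0#) (K.element-index K.0#)) ⟩
      u * 0# + s                                              ≈⟨ solve 2 (λ u s → u :* #0 :+ s := s) refl u s ⟩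
      s                                                       ∎
      where
      h : K.Carrier → Carrier
      h y = χ (x K.* y)
      extra : K.Carrier → Carrier
      extra y = indicator (y K.≟ K.0#) s
      ·≈* : ∀ m z → m · z ≈ m · 1# * z
      ·≈* m z = sym (trans (×-assoc-* m 1# z) (×-congʳ m (*-identityˡ z)))
      split : ∀ y → fibreSize f y · h y ≈ u * h y + extra y
      split y = by-cases (y K.≟ K.0#)
        where
        by-cases : (d : Dec (y K.≈ K.0#)) → fibreSize f y · h y ≈ u * h y + indicator d s
        by-cases (no y≉0)  = trans (·≈* (fibreSize f y) (h y)) (trans (*-congʳ (size-≉0 y≉0)) (sym (+-identityʳ _)))
        by-cases (yes y≈0) = begin
          fibreSize f y · h y            ≈⟨ ·≈* (fibreSize f y) (h y) ⟩
          fibreSize f y · 1# * h y       ≈⟨ *-congʳ (×-congˡ (fibreSize-cong f y≈0)) ⟩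
          fibreSize f K.0# · 1# * h y    ≈⟨ *-congʳ size-0 ⟩
          (u + s) * h y                  ≈⟨ distribʳ (h y) u s ⟩
          u * h y + s * h y              ≈⟨ +-congˡ (*-congˡ (χ-≈0 (K.trans (K.*-congˡ y≈0) (K.zeroʳ x)))) ⟩
          u * h y + s * 1#               ≈⟨ +-congˡ (*-identityʳ s) ⟩
          u * h y + s                    ∎

open import Data.Nat.Base using (_^_)

-- The Walsh transform and bentness.

module WalshProperties {r ℓ₁ ℓ₂ a ℓa b ℓb} (ℝ : RealNumbers r ℓ₁ ℓ₂)
  (π : RealNumbers.Carrier ℝ) (isPi : ComplexNumbers.IsPi ℝ π)
  (p : ℕ) (p-prime : Prime p)
  (ζ : ComplexNumbers.ℂ ℝ) (isZeta : ComplexNumbers.IsZeta ℝ π p {{prime⇒nonZero p-prime}} ζ)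
  (n m : ℕ) (𝔽ₙ : FiniteField a ℓa (p ^ n)) (𝔽ₘ : FiniteField b ℓb (p ^ m))
  (F : Func (FiniteField.setoid 𝔽ₙ) (FiniteField.setoid 𝔽ₘ))
  where
  open RealNumbers ℝ hiding (zero)
  open ComplexNumbers ℝ
  open RealProperties ℝ
  open ComplexProperties ℝ
  open Walsh ℝ p p-prime ζ n m 𝔽ₙ 𝔽ₘ F
  open Func F using (to)
  private
    module C = CommutativeRing ℂ-commutativeRing
    module R = CommutativeRing (RealNumbers.commutativeRing ℝ)
    module N where
      open FiniteField 𝔽ₙ public
      open FiniteFieldProperties 𝔽ₙ public
      open AbsoluteTrace p n 𝔽ₙ public
      open TraceProperties p-prime n 𝔽ₙ public
    module M = FiniteField 𝔽ₘ
  open IntegerSolver (RealNumbers.commutativeRing ℝ)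

  ζ^p : ζ ^ᶜ p ≈ᶜ 1ᶜ
  ζ^p = ζ^p≈1 isPi p-prime isZeta

  root : RootOfUnity ℂ-commutativeRing p
  root = record
    { ζ = ζ ; ζ⁻¹ = conj ζ ; ζ^p≈1 = ζ^p
    ; ζ*ζ⁻¹≈1  = ζ*ζ⁻¹≈1 p {{prime⇒nonZero p-prime}} ζ^p
    ; fixed⇒≈0 = fixed⇒≈0 }
    where
    open MonoidMultiples C.*-monoid using (coprime-·≈ε)
    open import Algebra.Properties.Ring C.ring using (x∙y⁻¹≈ε⇒x≈y)
    open SetoidReasoning C.setoid
    ζ*ζ⁻¹≈1 : ∀ p .{{_ : ℕ.NonZero p}} → ζ ^ᶜ p ≈ᶜ 1ᶜ → ζ *ᶜ conj ζ ≈ᶜ 1ᶜ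
    ζ*ζ⁻¹≈1 (suc p) = ζ*conjζ≈1 p
    fixed⇒≈0 : ∀ k {s} → p ∤ k → ζ ^ᶜ k *ᶜ s ≈ᶜ s → s ≈ᶜ 0ᶜ
    fixed⇒≈0 k {s} p∤k fixed = *-cancelˡ-≉0 ζ^k-1≉0 (begin
      (ζ ^ᶜ k C.- 1ᶜ) *ᶜ s               ≈⟨ C.distribʳ s (ζ ^ᶜ k) (-ᶜ 1ᶜ) ⟩
      ζ ^ᶜ k *ᶜ s +ᶜ (-ᶜ 1ᶜ) *ᶜ s        ≈⟨ C.+-cong fixed (-1*x≈-x s) ⟩
      s C.- s                            ≈⟨ C.-‿inverseʳ s ⟩
      0ᶜ                                 ∎)
      where
      open import Algebra.Properties.Ring C.ring using (-1*x≈-x)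
      -- Otherwise ζ^k and ζ^p would both be 1 with `k` coprime to `p`, forcing ζ = 1.
      ζ^k-1≉0 : ¬ (ζ ^ᶜ k C.- 1ᶜ ≈ᶜ 0ᶜ)
      ζ^k-1≉0 eq = ζ≉1 isPi p-prime isZeta
        (coprime-·≈ε (prime∤⇒coprime p-prime p∤k) (x∙y⁻¹≈ε⇒x≈y _ _ eq) ζ^p)

  private
    module χₙ = Characters ℂ-commutativeRing p-prime root n 𝔽ₙ
    module χₘ = Characters ℂ-commutativeRing p-prime root m 𝔽ₘ
    open import Algebra.Properties.Semiring.Exp C.semiring using (^-homo-*; ^-congʳ; ^-congˡ)
    open import Algebra.Properties.Semiring.Mult C.semiring using () renaming (_×_ to _×ᶜ_)
    open import Algebra.Properties.Semiring.Sum C.semiring using () renaming (sum-cong-≋ to sumᶜ-cong)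

  g g⁻¹ : M.Carrier → Fin (p ^ n) → ℂ
  g   β i = χₘ.χ (β M.* to (N.element i))
  g⁻¹ β i = χₘ.χ⁻¹ (β M.* to (N.element i))

  g-inverse : ∀ β i → g β i *ᶜ g⁻¹ β i ≈ᶜ 1ᶜ
  g-inverse β i = χₘ.χ-inverse (β M.* to (N.element i))

  Ŵ Ŵ⁻¹ : M.Carrier → N.Carrier → ℂ
  Ŵ β   = χₙ.transform (g β) (g⁻¹ β) (g-inverse β)
  Ŵ⁻¹ β = χₙ.transform⁻¹ (g β) (g⁻¹ β) (g-inverse β)

  -- The truncated subtraction in the exponent is exact because `Tr` is at most `p`. Hence the power
  -- with exponent p - Tr(αx), multiplied by χ(αx), is ζ^p = 1, and it is the inverse character
  -- value.
  W≈Ŵ : ∀ β α → W β α ≈ᶜ Ŵ β α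
  W≈Ŵ β α = sumᶜ-cong (λ i → term (N.element i))
    where
    term : ∀ x → ζ ^ᶜ (AbsoluteTrace.Tr p m 𝔽ₘ (β M.* to x) ℕ.+ (p ℕ.∸ N.Tr (α N.* x))) ≈ᶜ
                 χₘ.χ (β M.* to x) *ᶜ χₙ.χ⁻¹ (α N.* x)
    term x = C.trans (^-homo-* ζ (AbsoluteTrace.Tr p m 𝔽ₘ (β M.* to x)) _)
      (C.*-congˡ (χₙ.χ⁻¹-unique (α N.* x) (C.trans (C.sym (^-homo-* ζ (N.Tr (α N.* x)) _))
        (C.trans (^-congʳ ζ (ℕ.m+[n∸m]≡n (N.Tr≤p (α N.* x)))) ζ^p))))

  Ŵ-cong : ∀ β {α α′} → α N.≈ α′ → Ŵ β α ≈ᶜ Ŵ β α′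
  Ŵ-cong β α≈α′ = sumᶜ-cong (λ i → C.*-congˡ {g β i} (χₙ.χ⁻¹-cong (N.*-congʳ α≈α′)))

  -- Conjugation exchanges `ζ` with `conj ζ`, which is the chosen `ζ⁻¹`. This identifies the product
  -- in the abstract Parseval identity with |W|².
  conj-Ŵ : ∀ β α → conj (Ŵ β α) ≈ᶜ Ŵ⁻¹ β α
  conj-Ŵ β α = C.trans (conj-sum (λ i → g β i *ᶜ χₙ.χ⁻¹ (α N.* N.element i))) (sumᶜ-cong (λ i →
    C.trans (conj-* (g β i) (χₙ.χ⁻¹ (α N.* N.element i)))
      (C.*-cong (conj-^ ζ (AbsoluteTrace.Tr p m 𝔽ₘ (β M.* to (N.element i)))) (C.trans (conj-^ (conj ζ) (N.Tr (α N.* N.element i))) (^-congˡ (N.Tr (α N.* N.element i)) conj-conj)))))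
    where
    conj-conj : conj (conj ζ) ≈ᶜ ζ
    conj-conj = refl , solve 1 (λ x → :- :- x := x) refl (im ζ)

  conj-cong : ∀ {z w} → z ≈ᶜ w → conj z ≈ᶜ conj w
  conj-cong (p , q) = p , -‿cong q

  ofReal-norm-W : ∀ β α → ofReal (norm (W β α)) ≈ᶜ Ŵ β α *ᶜ Ŵ⁻¹ β α
  ofReal-norm-W β α = C.trans (C.sym (*-conj (W β α)))
    (C.*-cong (W≈Ŵ β α) (C.trans (conj-cong (W≈Ŵ β α)) (conj-Ŵ β α)))

  ofReal-fromℕ : ∀ k → ofReal (fromℕ k) ≈ᶜ k ×ᶜ 1ᶜ
  ofReal-fromℕ zero    = refl , refl
  ofReal-fromℕ (suc k) = +-congˡ (proj₁ (ofReal-fromℕ k)) , trans (sym (+-identityˡ 0#)) (+-congˡ (proj₂ (ofReal-fromℕ k)))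

  open import Algebra.Properties.Semiring.Sum R.semiring using (sum; sum-cong-≋)

  parsevalᴿ : ∀ β → sum (λ k → norm (W β (N.element k))) ≈ fromℕ (p ^ n) * fromℕ (p ^ n)
  parsevalᴿ β = begin
    sum (λ k → norm (W β (N.element k)))
      ≈⟨ sum-cong-≋ (λ k → proj₁ (ofReal-norm-W β (N.element k))) ⟩
    sum (λ k → re (Ŵ β (N.element k) *ᶜ Ŵ⁻¹ β (N.element k)))
      ≈⟨ re-sum (λ k → Ŵ β (N.element k) *ᶜ Ŵ⁻¹ β (N.element k)) ⟨
    re (sumᶜ (λ k → Ŵ β (N.element k) *ᶜ Ŵ⁻¹ β (N.element k)))
      ≈⟨ proj₁ (χₙ.parseval (g β) (g⁻¹ β) (g-inverse β)) ⟩
    re ((p ^ n ℕ.* p ^ n) ×ᶜ 1ᶜ)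
      ≈⟨ proj₁ (ofReal-fromℕ (p ^ n ℕ.* p ^ n)) ⟨
    fromℕ (p ^ n ℕ.* p ^ n)
      ≈⟨ fromℕ-* (p ^ n) (p ^ n) ⟩
    fromℕ (p ^ n) * fromℕ (p ^ n) ∎
    where open SetoidReasoning R.setoid

  W-0≈ofReal : ∀ {u s} → fromℕ (preimageSize M.0#) ≈ u + s → (∀ β → ¬ (β M.≈ M.0#) → fromℕ (preimageSize β) ≈ u) →
             ∀ β → ¬ (β M.≈ M.0#) → W β N.0# ≈ᶜ ofReal s
  W-0≈ofReal {u} {s} size-0 size-≉0 β β≉0 = C.trans (W≈Ŵ β N.0#) (C.trans
    (sumᶜ-cong (λ i → C.trans (C.*-congˡ {g β i} (χₙ.χ⁻¹-≈0 (N.zeroˡ (N.element i)))) (C.*-identityʳ (g β i))))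
    (χₘ.∑χ∘F to N.element {ofReal u} {ofReal s}
      (C.trans (C.sym (ofReal-fromℕ (preimageSize M.0#))) (size-0 , sym (+-identityˡ 0#)))
      (λ {y} y≉0 → C.trans (C.sym (ofReal-fromℕ (preimageSize y))) (size-≉0 y y≉0 , refl))
      β≉0))

  W-cong : ∀ β {α α′} → α N.≈ α′ → W β α ≈ᶜ W β α′
  W-cong β {α} {α′} α≈α′ = C.trans (W≈Ŵ β α) (C.trans (Ŵ-cong β α≈α′) (C.sym (W≈Ŵ β α′)))

  ∣∣² : ∀ z → ∣ z ∣ * ∣ z ∣ ≈ norm z
  ∣∣² z = √-square (0≤norm z)

  p^½² : ∀ k → (p^½ k) * (p^½ k) ≈ fromℕ (p ^ k)
  p^½² k = √-square (0≤fromℕ (p ^ k))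

  ∣∣≈0⇒norm≈0 : ∀ {z} → ∣ z ∣ ≈ 0# → norm z ≈ 0#
  ∣∣≈0⇒norm≈0 {z} ∣z∣≈0 = trans (sym (∣∣² z)) (trans (*-congʳ ∣z∣≈0) (zeroˡ _))

  ∣∣≈p^½⇒norm≈p^ : ∀ k {z} → ∣ z ∣ ≈ p^½ k → norm z ≈ fromℕ (p ^ k)
  ∣∣≈p^½⇒norm≈p^ k {z} ∣z∣≈ = trans (sym (∣∣² z)) (trans (*-cong ∣z∣≈ ∣z∣≈) (p^½² k))

  p^≉0 : ∀ k → ¬ (fromℕ (p ^ k) ≈ 0#)
  p^≉0 k eq = <.irrefl (sym eq) (0<fromℕ (p ^ k) {{ℕ.m^n≢0 p k {{prime⇒nonZero p-prime}}}})

  amplitude-0 : ∀ s → fromℕ (p ^ (n ℕ.+ s)) ≈ fromℕ (p ^ n) → s ≡ 0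
  amplitude-0 zero    _  = ≡.refl
  amplitude-0 (suc s) eq = contradiction (≡.sym (fromℕ-injective eq))
    (ℕ.<⇒≢ (ℕ.^-monoʳ-< p (ℕ.nonTrivial⇒n>1 p {{prime⇒nonTrivial p-prime}}) (ℕ.m<m+n n ℕ.z<s)))

  -- Write q = p^n. Each defect q - |W|² is `q` or 0, hence nonnegative, and by Parseval the `q`
  -- defects add up to q² - q² = 0. So every defect is zero, whereas a zero amplitude would have
  -- defect `q`.
  bent-at : ∀ β → (∀ α → (∣ W β α ∣ ≈ 0#) ⊎ (∣ W β α ∣ ≈ p^½ n)) → ∀ α → ∣ W β α ∣ ≈ p^½ n
  bent-at β plateau α with plateau α
  ... | inj₂ ∣W∣≈ = ∣W∣≈
  ... | inj₁ ∣W∣≈0 = contradiction fromℕq≈0 (p^≉0 n)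
    where
    open SetoidReasoning R.setoid
    q = fromℕ (p ^ n)
    defect : N.Carrier → Carrier
    defect α = q - norm (W β α)
    0≤defect : ∀ α → 0# ≤ defect α
    0≤defect α with plateau α
    ... | inj₁ ∣W∣≈0 = 0≤-resp (trans (solve 1 (λ x → x := x :- #0) refl q) (+-congˡ (-‿cong (sym (∣∣≈0⇒norm≈0 ∣W∣≈0))))) (0≤fromℕ (p ^ n))
    ... | inj₂ ∣W∣≈  = 0≤-resp (trans (sym (-‿inverseʳ q)) (+-congˡ (-‿cong (sym (∣∣≈p^½⇒norm≈p^ n ∣W∣≈))))) 0≮0
    ∑defect≈0 : sum (λ k → defect (N.element k)) ≈ 0#
    ∑defect≈0 = begin
      sum (λ k → defect (N.element k))                              ≈⟨ sum-sub (λ _ → q) (λ k → norm (W β (N.element k))) ⟩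
      sum {p ^ n} (λ _ → q) - sum (λ k → norm (W β (N.element k)))  ≈⟨ +-cong (sum-const (p ^ n) q) (-‿cong (parsevalᴿ β)) ⟩
      q * q - q * q                                                 ≈⟨ -‿inverseʳ (q * q) ⟩
      0#                                                            ∎
    norm≈q : norm (W β α) ≈ q
    norm≈q = begin
      norm (W β α)                            ≈⟨ norm-cong (W-cong β (N.element-index α)) ⟨
      norm (W β (N.element (N.index α)))      ≈⟨ solve 2 (λ x y → x := y :- (y :- x)) refl _ q ⟩
      q - defect (N.element (N.index α))      ≈⟨ +-congˡ (-‿cong (sum-0≤≈0⇒≈0 (λ k → defect (N.element k)) (λ k → 0≤defect (N.element k)) ∑defect≈0 (N.index α))) ⟩
      q - 0#                                  ≈⟨ solve 1 (λ x → x :- #0 := x) refl q ⟩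
      q                                       ∎
    fromℕq≈0 : q ≈ 0#
    fromℕq≈0 = trans (sym norm≈q) (∣∣≈0⇒norm≈0 ∣W∣≈0)

  -- The amplitude is the same for all `α`, so it can be read off at zero: there |W|² = p^n is
  -- nonzero, hence equal to p^(n+s), and s = 0.
  plateaued⇒bent : Plateaued → (∀ β → ¬ (β M.≈ M.0#) → norm (W β N.0#) ≈ fromℕ (p ^ n)) → Bent
  plateaued⇒bent plateaued norm-W-0 β β≉0 with plateaued β β≉0
  ... | s , _ , plateau = bent-at β (≡.subst (λ k → ∀ α → (∣ W β α ∣ ≈ 0#) ⊎ (∣ W β α ∣ ≈ p^½ k)) n+s≡n plateau)
    where
    s≡0 : s ≡ 0
    s≡0 with plateau N.0#
    ... | inj₁ ∣W∣≈0 = contradiction (trans (sym (norm-W-0 β β≉0)) (∣∣≈0⇒norm≈0 ∣W∣≈0)) (p^≉0 n)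
    ... | inj₂ ∣W∣≈  = amplitude-0 s (trans (sym (∣∣≈p^½⇒norm≈p^ (n ℕ.+ s) ∣W∣≈)) (norm-W-0 β β≉0))
    n+s≡n : n ℕ.+ s ≡ n
    n+s≡n = ≡.trans (≡.cong (n ℕ.+_) s≡0) (ℕ.+-identityʳ n)

  W-0-type⁺ : Type⁺ → ∀ β → ¬ (β M.≈ M.0#) → W β N.0# ≈ᶜ ofReal (p^½ n)
  W-0-type⁺ (size-0 , size-≉0) = W-0≈ofReal
    (trans size-0 (solve 3 (λ x y z → x :+ y :- z := x :- z :+ y) refl p^[n-m] (p^½ n) p^[n/2-m])) size-≉0

  W-0-type⁻ : Type⁻ → ∀ β → ¬ (β M.≈ M.0#) → W β N.0# ≈ᶜ (-ᶜ ofReal (p^½ n))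
  W-0-type⁻ (size-0 , size-≉0) β β≉0 = C.trans (W-0≈ofReal
    (trans size-0 (solve 3 (λ x y z → x :- y :+ z := x :+ z :- y) refl p^[n-m] (p^½ n) p^[n/2-m])) size-≉0 β β≉0)
    (refl , solve 0 (#0 := :- #0) refl)

  norm-W-0 : Type⁺ ⊎ Type⁻ → ∀ β → ¬ (β M.≈ M.0#) → norm (W β N.0#) ≈ fromℕ (p ^ n)
  norm-W-0 (inj₁ type⁺) β β≉0 = trans (norm-cong (W-0-type⁺ type⁺ β β≉0))
    (trans (solve 1 (λ x → x :* x :+ #0 :* #0 := x :* x) refl (p^½ n)) (p^½² n))
  norm-W-0 (inj₂ type⁻) β β≉0 = trans (norm-cong (W-0-type⁻ type⁻ β β≉0))
    (trans (solve 1 (λ x → :- x :* :- x :+ :- #0 :* :- #0 := x :* x) refl (p^½ n)) (p^½² n))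

theorem4p2 : ∀ {r ℓ₁ ℓ₂ a ℓa b ℓb} (ℝ : RealNumbers r ℓ₁ ℓ₂) →
  let open ComplexNumbers ℝ in
  ∀ (π : RealNumbers.Carrier ℝ) → IsPi π →
  ∀ (p : ℕ) (p-prime : Prime p) →
  ∀ (ζ : ℂ) → IsZeta π p {{prime⇒nonZero p-prime}} ζ →
  ∀ (n m : ℕ) (𝔽ₙ : FiniteField a ℓa (p ^ n)) (𝔽ₘ : FiniteField b ℓb (p ^ m)) →
  ∀ (F : Func (FiniteField.setoid 𝔽ₙ) (FiniteField.setoid 𝔽ₘ)) →
  let open Walsh ℝ p p-prime ζ n m 𝔽ₙ 𝔽ₘ F
      open FiniteField 𝔽ₘ using (_≈_)
      0ₙ = FiniteField.0# 𝔽ₙ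
      0ₘ = FiniteField.0# 𝔽ₘ in
  Plateaued →
  Type⁺ ⊎ Type⁻ →
  Bent
    × (Type⁻ → ∀ β → ¬ (β ≈ 0ₘ) → W β 0ₙ ≈ᶜ (-ᶜ ofReal (p^½ n)))
    × (Type⁺ → ∀ β → ¬ (β ≈ 0ₘ) → W β 0ₙ ≈ᶜ ofReal (p^½ n))
theorem4p2 ℝ π isPi p p-prime ζ isZeta n m 𝔽ₙ 𝔽ₘ F plateaued type± =
  plateaued⇒bent plateaued (norm-W-0 type±) , W-0-type⁻ , W-0-type⁺
  where open WalshProperties ℝ π isPi p p-prime ζ isZeta n m 𝔽ₙ 𝔽ₘ F
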